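{- Let $\mathcal{P}_1$ (resp. $\mathcal{P}_2$) be the set of partitions whose even-indexed (resp. odd-indexed) parts are all even. Then, as formal power series in $q$ with coefficients Laurent polynomials in $z$, $$\sum_{\lambda\in\mathcal{P}_{1}}z^{\mathrm{BG}(\lambda)}q^{|\lambda|}=\sum_{n=0}^{\infty}\frac{q^{4n}(-zq^{ -3};q^{4})_{n}}{(q^{2};q^{2})_{2n}}+\sum_{n=0}^{\infty}\frac{q^{4n+2}(-zq;q^{4})_{n}}{(q^2;q^2)_{2n+1}}=\frac{(-zq;q^4)_{\infty}}{(q^2;q^2)_{\infty}},$$ $$\sum_{\lambda\in\mathcal{P}_{2}}z^{\mathrm{BG}(\lambda)}q^{|\lambda|}=\sum_{n=0}^{\infty}\frac{q^{4n}(-z^{ -1}q^{ -1};q^{4})_{n}}{(q^{2};q^{2})_{2n}}+\sum_{n=0}^{\infty}\frac{q^{4n+2}(-z^{ -1}q^{3};q^4)_{n}}{(q^{2};q^{2})_{2n+1}}=\frac{(-z^{ -1}q^3;q^4)_{\infty}}{(q^{2};q^{2})_{\infty}}.$$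
   Context: A partition is a finite weakly decreasing sequence $\lambda=(\lambda_1,\ldots,\lambda_\ell)$ of positive integers (empty partition included). $|\lambda|=\sum_i\lambda_i$. The BG-rank $\mathrm{BG}(\lambda)$ is the number of odd parts among $\lambda_1,\lambda_3,\lambda_5,\ldots$ minus the number of odd parts among $\lambda_2,\lambda_4,\ldots$. $(x;q)_0=1$, $(x;q)_n=\prod_{i=0}^{n-1}(1-xq^i)$, $(x;q)_\infty=\prod_{i\ge0}(1-xq^i)$. -}

module Defs where

open import Data.Nat as ℕ using (ℕ; zero; suc; _≤_; _≥_)
open import Data.Nat.Divisibility using (_∣_)
open import Data.Integer as ℤ using (ℤ; +_; -[1+_])
open import Data.Product using (_×_; _,_)
open import Data.List using (List; []; _∷_; _++_; map; concatMap; foldr)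
open import Data.Nat.ListAction using (sum)
open import Data.Unit using (⊤)
open import Relation.Nullary.Decidable using (does)
open import Data.Bool using (if_then_else_; _∧_)

data Decreasing : List ℕ → Set where
  dec-[] : Decreasing []
  dec-one : ∀ x → Decreasing (x ∷ [])
  dec-cons : ∀ {x y ys} → x ≥ y → Decreasing (y ∷ ys) → Decreasing (x ∷ y ∷ ys)

data AllPositive : List ℕ → Set where
  pos-[] : AllPositive []
  pos-∷ : ∀ {x xs} → 1 ≤ x → AllPositive xs → AllPositive (x ∷ xs)

IsPartition : List ℕ → Set
IsPartition λs = Decreasing λs × AllPositive λs

size : List ℕ → ℕ
size = sum

-- Odd-indexed parts λ₁, λ₃, … all even / even-indexed parts λ₂, λ₄, … all even.
mutual
  OddIdxEven : List ℕ → Set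
  OddIdxEven [] = ⊤
  OddIdxEven (x ∷ xs) = (2 ∣ x) × EvenIdxEven xs

  EvenIdxEven : List ℕ → Set
  EvenIdxEven [] = ⊤
  EvenIdxEven (x ∷ xs) = OddIdxEven xs

InP1 : List ℕ → Set
InP1 = EvenIdxEven

InP2 : List ℕ → Set
InP2 = OddIdxEven

isOdd : ℕ → ℕ
isOdd n = n ℕ.% 2

mutual
  oddsAtOddIdx : List ℕ → ℕ
  oddsAtOddIdx [] = 0
  oddsAtOddIdx (x ∷ xs) = isOdd x ℕ.+ oddsAtEvenIdx xs

  oddsAtEvenIdx : List ℕ → ℕ
  oddsAtEvenIdx [] = 0
  oddsAtEvenIdx (x ∷ xs) = oddsAtOddIdx xs

BG : List ℕ → ℤ
BG λs = + oddsAtOddIdx λs ℤ.- + oddsAtEvenIdx λs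

-- Laurent polynomials in z and q with integer coefficients, as
-- (unnormalised) lists of monomials (c , a , b) meaning c·z^a·q^b.

Poly : Set
Poly = List (ℤ × ℤ × ℤ)

mono : ℤ → ℤ → ℤ → Poly
mono c a b = (c , a , b) ∷ []

𝟘 𝟙 : Poly
𝟘 = []
𝟙 = mono (+ 1) (+ 0) (+ 0)

_⊕_ : Poly → Poly → Poly
_⊕_ = _++_

neg : Poly → Poly
neg = map (λ { (c , a , b) → (ℤ.- c , a , b) })

_⊖_ : Poly → Poly → Poly
p ⊖ r = p ⊕ neg r

_⊗_ : Poly → Poly → Poly
p ⊗ r = concatMap (λ { (c , a , b) → map (λ { (c' , a' , b') → (c ℤ.* c' , a ℤ.+ a' , b ℤ.+ b') }) r }) p

infixl 6 _⊕_ _⊖_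
infixl 7 _⊗_

qpow : ℤ → Poly
qpow e = mono (+ 1) (+ 0) e

coeff : Poly → ℤ → ℤ → ℤ
coeff p k N = foldr ℤ._+_ (+ 0) (map (λ { (c , a , b) → if does (a ℤ.≟ k) ∧ does (b ℤ.≟ N) then c else + 0 }) p)

sumBelow : ℕ → (ℕ → Poly) → Poly
sumBelow zero f = 𝟘
sumBelow (suc M) f = sumBelow M f ⊕ f M

prodBelow : ℕ → (ℕ → Poly) → Poly
prodBelow zero f = 𝟙
prodBelow (suc M) f = prodBelow M f ⊗ f M

poch : Poly → ℕ → ℕ → Poly
poch a s n = prodBelow n (λ i → 𝟙 ⊖ a ⊗ qpow (+ (s ℕ.* i)))

-- Truncation at order M of 1/(1 - q^d) = Σ_{k ≥ 0} q^{d k}:  Σ_{k ≤ M} q^{d k}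
geomT : ℕ → ℕ → Poly
geomT M d = sumBelow (suc M) (λ k → qpow (+ (d ℕ.* k)))

invQ2T : ℕ → ℕ → Poly
invQ2T M m = prodBelow m (λ i → geomT M (2 ℕ.* suc i))

-- The series of the theorem, truncated at level M (partial sums n < M,
-- partial products i < M, geometric series up to q^{dM}).

doubleSumT : Poly → Poly → ℕ → Poly
doubleSumT a b M =
  sumBelow M (λ n → qpow (+ (4 ℕ.* n)) ⊗ poch a 4 n ⊗ invQ2T M (2 ℕ.* n))
  ⊕ sumBelow M (λ n → qpow (+ (4 ℕ.* n ℕ.+ 2)) ⊗ poch b 4 n ⊗ invQ2T M (suc (2 ℕ.* n)))

productT : Poly → ℕ → Poly
productT c M = poch c 4 M ⊗ invQ2T M M

-zq⁻³ -zq -z⁻¹q⁻¹ -z⁻¹q³ : Poly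
-zq⁻³ = mono (ℤ.- + 1) (+ 1) (ℤ.- + 3)
-zq = mono (ℤ.- + 1) (+ 1) (+ 1)
-z⁻¹q⁻¹ = mono (ℤ.- + 1) (ℤ.- + 1) (ℤ.- + 1)
-z⁻¹q³ = mono (ℤ.- + 1) (ℤ.- + 1) (+ 3)

open import Data.List.Membership.Propositional using (_∈_)
open import Data.List.Relation.Unary.Unique.Propositional using (Unique)
open import Function.Bundles using (_⇔_)
open import Data.List using (length)
open import Relation.Binary.PropositionalEquality using (_≡_)
open import Data.Product using (Σ)

CountIs : (List ℕ → Set) → ℕ → ℤ → ℤ → Set
CountIs P N k c =
  Σ (List (List ℕ)) λ L →
    Unique L
    × (∀ λs → (λs ∈ L) ⇔ (IsPartition λs × size λs ≡ N × P λs × BG λs ≡ k))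
    × + length L ≡ c

-- Each series of the statement is a list of monomials with coefficient one, so the coefficient
-- of z^k q^N counts the terms of weight (k , N), and the theorem follows from weight-preserving
-- bijections between terms and partitions (the truncation at level M is invisible once N < M).
-- A partition λ is determined by its differences cᵢ = λᵢ − λᵢ₊₁, and |λ| = Σ i cᵢ.  For λ ∈ 𝒫₂
-- the differences pair up as (c₂ⱼ₋₁ , c₂ⱼ) = (2x₂ⱼ₋₁ + βⱼ , 2x₂ⱼ + βⱼ), where βⱼ is the parity of
-- λ₂ⱼ, and an unpaired last difference is even; βⱼ = 1 contributes z⁻¹q^(4j−1) and xᵢ contributes
-- q^(2i xᵢ), which is a term of (−z⁻¹q³;q⁴)_∞/(q²;q²)_∞.  For 𝒫₁ the first difference stands
-- alone and the pairs are (c₂ⱼ , c₂ⱼ₊₁).  Reading the parity of the last pair as the first factor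
-- of (a;q⁴)_n turns the same data into a term of the n-th summand of one of the two sums.

module Submission where

open import Defs
open import Data.Bool using (Bool; true; false; if_then_else_; not)
open import Data.Empty using (⊥)
open import Data.Integer as ℤ using (ℤ; +_)
import Data.Integer.Properties as ℤₚ
open import Data.Integer.Tactic.RingSolver as ℤ-Solver using ()
open import Data.List
  using (List; []; _∷_; _++_; _∷ʳ_; [_]; map; length; replicate; filter; cartesianProduct; upTo; initLast; _∷ʳ′_)
open import Data.List.Properties
  using (map-++; map-∘; length-map; ++-identityʳ; ++-assoc; upTo-∷ʳ; length-++; length-replicate; ∷ʳ-injective; ∷-injective;
         map-cong-local; map-replicate; map-injective)
open import Data.List.Membership.Propositional using (_∈_)
open import Data.List.Membership.Propositional.Properties
  using (∈-filter⁺; ∈-filter⁻; ∈-map⁺; ∈-map⁻; ∈-cartesianProduct⁺; ∈-cartesianProduct⁻; ∈-++⁺ˡ; ∈-++⁺ʳ; ∈-++⁻; ∈-upTo⁺; ∈-upTo⁻)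
open import Data.List.Membership.Propositional.Properties.WithK using (unique∧set⇒bag)
open import Data.List.Relation.Binary.BagAndSetEquality using (∼bag⇒↭)
open import Data.List.Relation.Binary.Permutation.Propositional.Properties using (↭-length)
open import Data.List.Relation.Unary.All as All using (All; []; _∷_)
import Data.List.Relation.Unary.All.Properties as All
open import Data.List.Relation.Unary.AllPairs using ([]; _∷_)
open import Data.List.Relation.Unary.Any using (here; there)
open import Data.List.Relation.Unary.Unique.Propositional using (Unique)
import Data.List.Relation.Unary.Unique.Propositional.Properties as Unique
open import Data.Nat as ℕ using (ℕ; zero; suc; _+_; _*_; _∸_; _≤_; _<_; z≤n; s≤s; ⌊_/2⌋; pred)
import Data.Nat.Properties as ℕₚ
open import Data.Nat.DivMod using ([m+kn]%n≡m%n)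
open import Data.Nat.Divisibility using (_∣_; divides; ∣m∣n⇒∣m+n; m∣m*n; n∣m⇒m%n≡0)
open import Data.Nat.ListAction using (sum)
open import Data.Nat.Tactic.RingSolver using (solve-∀)
open import Data.Product using (_×_; _,_; proj₁; proj₂; ∃-syntax; uncurry)
open import Data.Sum using (inj₁; inj₂)
open import Data.Unit using (⊤; tt)
open import Function using (_∘_; _⇔_; mk⇔; Equivalence)
open import Relation.Binary.PropositionalEquality hiding ([_])
open import Relation.Nullary using (¬_; contradiction)
open import Relation.Nullary.Decidable using (Dec; yes; no; _×-dec_)

-- Generating functions with unit coefficients

Weight : Set
Weight = ℤ × ℤ

0ʷ : Weight
0ʷ = + 0 , + 0

infixl 6 _+ʷ_

_+ʷ_ : Weight → Weight → Weight
(a , b) +ʷ (c , d) = a ℤ.+ c , b ℤ.+ d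

+ʷ-identityˡ : ∀ u → 0ʷ +ʷ u ≡ u
+ʷ-identityˡ (a , b) = cong₂ _,_ (ℤₚ.+-identityˡ a) (ℤₚ.+-identityˡ b)

+ʷ-identityʳ : ∀ u → u +ʷ 0ʷ ≡ u
+ʷ-identityʳ (a , b) = cong₂ _,_ (ℤₚ.+-identityʳ a) (ℤₚ.+-identityʳ b)

+ʷ-assoc : ∀ u v x → u +ʷ v +ʷ x ≡ u +ʷ (v +ʷ x)
+ʷ-assoc (a , b) (c , d) (e , f) = cong₂ _,_ (ℤₚ.+-assoc a c e) (ℤₚ.+-assoc b d f)

Σʷ : {C : Set} → (ℕ → C → Weight) → ℕ → List C → Weight
Σʷ w i [] = 0ʷ
Σʷ w i (c ∷ cs) = w i c +ʷ Σʷ w (suc i) cs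

length-∷ʳ : ∀ {C : Set} (cs : List C) c → length (cs ∷ʳ c) ≡ suc (length cs)
length-∷ʳ cs c = trans (length-++ cs) (ℕₚ.+-comm (length cs) 1)

Σʷ-∷ʳ : ∀ {C : Set} (w : ℕ → C → Weight) i cs c → Σʷ w i (cs ∷ʳ c) ≡ Σʷ w i cs +ʷ w (i + length cs) c
Σʷ-∷ʳ w i [] c = begin
  w i c +ʷ 0ʷ       ≡⟨ +ʷ-identityʳ _ ⟩
  w i c             ≡⟨ cong (λ j → w j c) (sym (ℕₚ.+-identityʳ i)) ⟩
  w (i + 0) c       ≡⟨ sym (+ʷ-identityˡ _) ⟩
  0ʷ +ʷ w (i + 0) c ∎
  where open ≡-Reasoning
Σʷ-∷ʳ w i (c′ ∷ cs) c = begin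
  w i c′ +ʷ Σʷ w (suc i) (cs ∷ʳ c)                      ≡⟨ cong (w i c′ +ʷ_) (Σʷ-∷ʳ w (suc i) cs c) ⟩
  w i c′ +ʷ (Σʷ w (suc i) cs +ʷ w (suc i + length cs) c) ≡⟨ sym (+ʷ-assoc (w i c′) _ _) ⟩
  Σʷ w i (c′ ∷ cs) +ʷ w (suc i + length cs) c
    ≡⟨ cong (λ j → Σʷ w i (c′ ∷ cs) +ʷ w j c) (sym (ℕₚ.+-suc i (length cs))) ⟩
  Σʷ w i (c′ ∷ cs) +ʷ w (i + length (c′ ∷ cs)) c        ∎
  where open ≡-Reasoning

Σʷ-shift : ∀ {C : Set} (w v : ℕ → C → Weight) → (∀ i c → w (suc i) c ≡ v i c) → ∀ i cs → Σʷ w (suc i) cs ≡ Σʷ v i cs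
Σʷ-shift w v w≡v i [] = refl
Σʷ-shift w v w≡v i (c ∷ cs) = cong₂ _+ʷ_ (w≡v i c) (Σʷ-shift w v w≡v (suc i) cs)

genFun : {A : Set} → (A → Weight) → List A → Poly
genFun w = map (λ x → + 1 , w x)

module _ {A : Set} (w : A → Weight) where

  genFun-++ : ∀ xs ys → genFun w (xs ++ ys) ≡ genFun w xs ⊕ genFun w ys
  genFun-++ xs ys = map-++ _ xs ys

  genFun-map : ∀ {B : Set} (f : B → A) xs → genFun w (map f xs) ≡ genFun (w ∘ f) xs
  genFun-map f xs = sym (map-∘ xs)

genFun-⊗ : ∀ {A B : Set} (v : A → Weight) (w : B → Weight) xs ys →
  genFun v xs ⊗ genFun w ys ≡ genFun (λ (x , y) → v x +ʷ w y) (cartesianProduct xs ys)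
genFun-⊗ v w [] ys = refl
genFun-⊗ v w (x ∷ xs) ys = begin
  genFun v (x ∷ xs) ⊗ genFun w ys
    ≡⟨ cong₂ _++_ (trans (sym (map-∘ ys)) (sym (genFun-map _ (x ,_) ys))) (genFun-⊗ v w xs ys) ⟩
  genFun _ (map (x ,_) ys) ++ genFun _ (cartesianProduct xs ys)
    ≡⟨ sym (genFun-++ _ (map (x ,_) ys) _) ⟩
  genFun _ (cartesianProduct (x ∷ xs) ys) ∎
  where open ≡-Reasoning

tuples : {C : Set} → ℕ → List C → List (List C)
tuples zero ys = [ [] ]
tuples (suc n) ys = map (uncurry _∷ʳ_) (cartesianProduct (tuples n ys) ys)

module _ {C : Set} {ys : List C} where

  ∈-tuples⁻ : ∀ n {cs} → cs ∈ tuples n ys → length cs ≡ n × All (_∈ ys) cs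
  ∈-tuples⁻ zero (here refl) = refl , []
  ∈-tuples⁻ (suc n) cs∈ with ∈-map⁻ (uncurry _∷ʳ_) cs∈
  ... | (cs , c) , p∈ , refl =
    let (cs∈ , c∈) = ∈-cartesianProduct⁻ (tuples n ys) ys p∈ ; (len , all) = ∈-tuples⁻ n cs∈ in
    trans (length-∷ʳ cs c) (cong suc len) , All.∷ʳ⁺ all c∈

  ∈-tuples⁺ : ∀ n {cs} → length cs ≡ n → All (_∈ ys) cs → cs ∈ tuples n ys
  ∈-tuples⁺ n {cs} len all with initLast cs
  ∈-tuples⁺ zero len all | [] = here refl
  ∈-tuples⁺ (suc n) len all | cs ∷ʳ′ c =
    let (all′ , c∈) = All.∷ʳ⁻ all in
    ∈-map⁺ (uncurry _∷ʳ_) (∈-cartesianProduct⁺ (∈-tuples⁺ n (ℕₚ.suc-injective (trans (sym (length-∷ʳ cs c)) len)) all′) c∈)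
  ∈-tuples⁺ zero len all | cs ∷ʳ′ c = contradiction (trans (sym (length-∷ʳ cs c)) len) λ ()
  ∈-tuples⁺ (suc n) () all | []

  tuples-unique : ∀ n → Unique ys → Unique (tuples n ys)
  tuples-unique zero u = [] ∷ []
  tuples-unique (suc n) u =
    Unique.map⁺ (λ {p} {q} eq → let (e₁ , e₂) = ∷ʳ-injective (proj₁ p) (proj₁ q) eq in cong₂ _,_ e₁ e₂)
      (Unique.cartesianProduct⁺ (tuples-unique n u) u)

prodBelow-genFun : ∀ {C : Set} n (ys : List C) (w : ℕ → C → Weight) (f : ℕ → Poly) →
  (∀ i → f i ≡ genFun (w i) ys) → prodBelow n f ≡ genFun (Σʷ w 0) (tuples n ys)
prodBelow-genFun zero ys w f f≡ = refl
prodBelow-genFun (suc n) ys w f f≡ = begin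
  prodBelow n f ⊗ f n
    ≡⟨ cong₂ _⊗_ (prodBelow-genFun n ys w f f≡) (f≡ n) ⟩
  genFun (Σʷ w 0) (tuples n ys) ⊗ genFun (w n) ys
    ≡⟨ genFun-⊗ (Σʷ w 0) (w n) (tuples n ys) ys ⟩
  genFun (λ (cs , c) → Σʷ w 0 cs +ʷ w n c) (cartesianProduct (tuples n ys) ys)
    ≡⟨ map-cong-local (All.tabulate snoc-weight) ⟩
  genFun (Σʷ w 0 ∘ uncurry _∷ʳ_) (cartesianProduct (tuples n ys) ys)
    ≡⟨ sym (genFun-map (Σʷ w 0) (uncurry _∷ʳ_) _) ⟩
  genFun (Σʷ w 0) (tuples (suc n) ys) ∎
  where
  open ≡-Reasoning
  snoc-weight : ∀ {p} → p ∈ cartesianProduct (tuples n ys) ys →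
    (+ 1 , Σʷ w 0 (proj₁ p) +ʷ w n (proj₂ p)) ≡ (+ 1 , Σʷ w 0 (proj₁ p ∷ʳ proj₂ p))
  snoc-weight {cs , c} p∈ = cong (+ 1 ,_) (sym (trans (Σʷ-∷ʳ w 0 cs c)
    (cong (λ j → Σʷ w 0 cs +ʷ w j c) (proj₁ (∈-tuples⁻ n (proj₁ (∈-cartesianProduct⁻ (tuples n ys) ys p∈)))))))

sumBelow-monomials : ∀ n (w : ℕ → Weight) → sumBelow n (λ i → genFun w [ i ]) ≡ genFun w (upTo n)
sumBelow-monomials zero w = refl
sumBelow-monomials (suc n) w = begin
  sumBelow n (λ i → genFun w [ i ]) ⊕ genFun w [ n ] ≡⟨ cong (_⊕ genFun w [ n ]) (sumBelow-monomials n w) ⟩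
  genFun w (upTo n) ⊕ genFun w [ n ]                ≡⟨ sym (genFun-++ w (upTo n) [ n ]) ⟩
  genFun w (upTo n ∷ʳ n)                            ≡⟨ cong (genFun w) (upTo-∷ʳ n) ⟩
  genFun w (upTo (suc n))                           ∎
  where open ≡-Reasoning

sigmaBelow : {C : Set} → ℕ → (ℕ → List C) → List (ℕ × C)
sigmaBelow zero xs = []
sigmaBelow (suc n) xs = sigmaBelow n xs ++ map (n ,_) (xs n)

module _ {C : Set} (xs : ℕ → List C) where

  ∈-sigmaBelow⁻ : ∀ n {i c} → (i , c) ∈ sigmaBelow n xs → i < n × c ∈ xs i
  ∈-sigmaBelow⁻ (suc n) p∈ with ∈-++⁻ (sigmaBelow n xs) p∈
  ... | inj₁ p∈′ = let (i<n , c∈) = ∈-sigmaBelow⁻ n p∈′ in ℕₚ.m<n⇒m<1+n i<n , c∈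
  ... | inj₂ p∈′ with ∈-map⁻ (n ,_) p∈′
  ... | c , c∈ , refl = ℕₚ.n<1+n n , c∈

  ∈-sigmaBelow⁺ : ∀ n {i c} → i < n → c ∈ xs i → (i , c) ∈ sigmaBelow n xs
  ∈-sigmaBelow⁺ (suc n) i<1+n c∈ with ℕₚ.m≤n⇒m<n∨m≡n (ℕₚ.≤-pred i<1+n)
  ... | inj₁ i<n = ∈-++⁺ˡ (∈-sigmaBelow⁺ n i<n c∈)
  ... | inj₂ refl = ∈-++⁺ʳ (sigmaBelow n xs) (∈-map⁺ (n ,_) c∈)

  sigmaBelow-unique : ∀ n → (∀ i → Unique (xs i)) → Unique (sigmaBelow n xs)
  sigmaBelow-unique zero u = []
  sigmaBelow-unique (suc n) u =
    Unique.++⁺ (sigmaBelow-unique n u) (Unique.map⁺ (cong proj₂) (u n)) λ (p∈ , q∈) →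
      let (c , _ , p≡) = ∈-map⁻ (n ,_) q∈ in
      ℕₚ.<-irrefl (cong proj₁ p≡) (proj₁ (∈-sigmaBelow⁻ n p∈))

sumBelow-genFun : ∀ {C : Set} n (xs : ℕ → List C) (w : ℕ → C → Weight) (f : ℕ → Poly) →
  (∀ i → f i ≡ genFun (w i) (xs i)) → sumBelow n f ≡ genFun (uncurry w) (sigmaBelow n xs)
sumBelow-genFun zero xs w f f≡ = refl
sumBelow-genFun (suc n) xs w f f≡ = begin
  sumBelow n f ⊕ f n
    ≡⟨ cong₂ _⊕_ (sumBelow-genFun n xs w f f≡) (trans (f≡ n) (sym (genFun-map (uncurry w) (n ,_) (xs n)))) ⟩
  genFun (uncurry w) (sigmaBelow n xs) ⊕ genFun (uncurry w) (map (n ,_) (xs n))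
    ≡⟨ sym (genFun-++ (uncurry w) (sigmaBelow n xs) _) ⟩
  genFun (uncurry w) (sigmaBelow (suc n) xs) ∎
  where open ≡-Reasoning

-- Counting monomials of a given weight

module _ {A : Set} (w : A → Weight) (k N : ℤ) where

  hasWeight? : ∀ x → Dec (proj₁ (w x) ≡ k × proj₂ (w x) ≡ N)
  hasWeight? x = proj₁ (w x) ℤ.≟ k ×-dec proj₂ (w x) ℤ.≟ N

  ofWeight : List A → List A
  ofWeight = filter hasWeight?

  coeff-genFun : ∀ xs → coeff (genFun w xs) k N ≡ + length (ofWeight xs)
  coeff-genFun [] = refl
  coeff-genFun (x ∷ xs) with proj₁ (w x) ℤ.≟ k | proj₂ (w x) ℤ.≟ N
  ... | yes _ | yes _ = cong ℤ.suc (coeff-genFun xs)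
  ... | yes _ | no _ = trans (ℤₚ.+-identityˡ _) (coeff-genFun xs)
  ... | no _ | _ = trans (ℤₚ.+-identityˡ _) (coeff-genFun xs)

PartitionOf : (List ℕ → Set) → ℕ → ℤ → List ℕ → Set
PartitionOf P N k λs = IsPartition λs × size λs ≡ N × P λs × BG λs ≡ k

map⁺-injectiveOn : ∀ {A B : Set} (f : A → B) {xs} → Unique xs →
  (∀ {x y} → x ∈ xs → y ∈ xs → f x ≡ f y → x ≡ y) → Unique (map f xs)
map⁺-injectiveOn f [] inj = []
map⁺-injectiveOn f (x∉xs ∷ u) inj =
  All.map⁺ (All.tabulate λ y∈xs fx≡fy → All.lookup x∉xs y∈xs (inj (here refl) (there y∈xs) fx≡fy))
  ∷ map⁺-injectiveOn f u (λ x∈ y∈ → inj (there x∈) (there y∈))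

module _ {A : Set} (w : A → Weight) (f : A → List ℕ) {P : List ℕ → Set} {N : ℕ} {k : ℤ} where

  countIs-genFun : ∀ {xs} → Unique xs →
    (∀ {x} → x ∈ xs → w x ≡ (k , + N) → PartitionOf P N k (f x)) →
    (∀ {x y} → x ∈ xs → y ∈ xs → w x ≡ (k , + N) → w y ≡ (k , + N) → f x ≡ f y → x ≡ y) →
    (∀ {λs} → PartitionOf P N k λs → ∃[ x ] x ∈ xs × w x ≡ (k , + N) × f x ≡ λs) →
    CountIs P N k (coeff (genFun w xs) k (+ N))
  countIs-genFun {xs} unique sound injective complete =
    map f selected ,
    map⁺-injectiveOn f (Unique.filter⁺ (hasWeight? w k (+ N)) unique)
      (λ x∈ y∈ → let (x∈xs , wx) = selected⁻ x∈ ; (y∈xs , wy) = selected⁻ y∈ in injective x∈xs y∈xs wx wy) ,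
    (λ λs → mk⇔ (to λs) from) ,
    trans (cong +_ (length-map f selected)) (sym (coeff-genFun w k (+ N) xs))
    where
    selected = ofWeight w k (+ N) xs
    selected⁻ : ∀ {x} → x ∈ selected → x ∈ xs × w x ≡ (k , + N)
    selected⁻ x∈ = let (x∈xs , (p , q)) = ∈-filter⁻ (hasWeight? w k (+ N)) x∈ in x∈xs , cong₂ _,_ p q
    to : ∀ λs → λs ∈ map f selected → PartitionOf P N k λs
    to λs λs∈ = let (x , x∈ , λs≡fx) = ∈-map⁻ f λs∈ ; (x∈xs , wx) = selected⁻ x∈ in
      subst (PartitionOf P N k) (sym λs≡fx) (sound x∈xs wx)
    from : ∀ {λs} → PartitionOf P N k λs → λs ∈ map f selected
    from p = let (x , x∈xs , wx , fx≡λs) = complete p in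
      subst (_∈ map f selected) fx≡λs (∈-map⁺ f (∈-filter⁺ (hasWeight? w k (+ N)) x∈xs (cong proj₁ wx , cong proj₂ wx)))

countIs-unique : ∀ {P N k c c′} → CountIs P N k c → CountIs P N k c′ → c ≡ c′
countIs-unique (L , uL , memL , c≡) (L′ , uL′ , memL′ , c′≡) =
  trans (sym c≡) (trans (cong +_ (↭-length (∼bag⇒↭ (unique∧set⇒bag uL uL′ sameMembers)))) c′≡)
  where
  sameMembers : ∀ {λs} → λs ∈ L ⇔ λs ∈ L′
  sameMembers {λs} = mk⇔ (Equivalence.from (memL′ λs) ∘ Equivalence.to (memL λs))
                         (Equivalence.from (memL λs) ∘ Equivalence.to (memL′ λs))

-- Partitions and their difference sequences

head₀ : List ℕ → ℕ
head₀ [] = 0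
head₀ (x ∷ _) = x

tail₀ : List ℕ → List ℕ
tail₀ [] = []
tail₀ (_ ∷ xs) = xs

infixr 5 _∷ₚ_

_∷ₚ_ : ℕ → List ℕ → List ℕ
x ∷ₚ (y ∷ ys) = x ∷ y ∷ ys
zero ∷ₚ [] = []
suc x ∷ₚ [] = suc x ∷ []

fromDiffs : List ℕ → List ℕ
fromDiffs [] = []
fromDiffs (c ∷ cs) = (c + head₀ (fromDiffs cs)) ∷ₚ fromDiffs cs

suffixSums : List ℕ → List ℕ
suffixSums [] = []
suffixSums (c ∷ cs) = (c + sum cs) ∷ suffixSums cs

diffs : List ℕ → List ℕ
diffs [] = []
diffs (x ∷ xs) = (x ∸ head₀ xs) ∷ diffs xs

dropTrailingZeros : List ℕ → List ℕ
dropTrailingZeros [] = []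
dropTrailingZeros (c ∷ cs) = c ∷ₚ dropTrailingZeros cs

head₀-∷ₚ : ∀ x ys → head₀ (x ∷ₚ ys) ≡ x
head₀-∷ₚ zero [] = refl
head₀-∷ₚ (suc x) [] = refl
head₀-∷ₚ x (y ∷ ys) = refl

head₀-fromDiffs : ∀ cs → head₀ (fromDiffs cs) ≡ sum cs
head₀-fromDiffs [] = refl
head₀-fromDiffs (c ∷ cs) = trans (head₀-∷ₚ _ (fromDiffs cs)) (cong (_+_ c) (head₀-fromDiffs cs))

fromDiffs-∷ : ∀ c cs → fromDiffs (c ∷ cs) ≡ (c + sum cs) ∷ₚ fromDiffs cs
fromDiffs-∷ c cs = cong (λ h → (c + h) ∷ₚ fromDiffs cs) (head₀-fromDiffs cs)

Stats : List ℕ → ℕ × ℕ × ℕ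
Stats λs = oddsAtOddIdx λs , oddsAtEvenIdx λs , size λs

Stats-∷ₚ : ∀ x ys → Stats (x ∷ₚ ys) ≡ Stats (x ∷ ys)
Stats-∷ₚ zero [] = refl
Stats-∷ₚ (suc x) [] = refl
Stats-∷ₚ x (y ∷ ys) = refl

Stats-fromDiffs : ∀ cs → Stats (fromDiffs cs) ≡ Stats (suffixSums cs)
Stats-fromDiffs [] = refl
Stats-fromDiffs (c ∷ cs) = begin
  Stats (fromDiffs (c ∷ cs))             ≡⟨ cong Stats (fromDiffs-∷ c cs) ⟩
  Stats ((c + sum cs) ∷ₚ fromDiffs cs)   ≡⟨ Stats-∷ₚ _ (fromDiffs cs) ⟩
  Stats ((c + sum cs) ∷ fromDiffs cs)    ≡⟨ cong (consStats (c + sum cs)) (Stats-fromDiffs cs) ⟩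
  Stats ((c + sum cs) ∷ suffixSums cs)   ∎
  where
  open ≡-Reasoning
  consStats : ℕ → ℕ × ℕ × ℕ → ℕ × ℕ × ℕ
  consStats x (o , e , s) = isOdd x + e , o , x + s

OddIdxEven-∷ₚ : ∀ x ys → OddIdxEven (x ∷ ys) → OddIdxEven (x ∷ₚ ys)
OddIdxEven-∷ₚ zero [] p = tt
OddIdxEven-∷ₚ (suc x) [] p = p
OddIdxEven-∷ₚ x (y ∷ ys) p = p

EvenIdxEven-∷ₚ : ∀ x ys → EvenIdxEven (x ∷ ys) → EvenIdxEven (x ∷ₚ ys)
EvenIdxEven-∷ₚ zero [] p = tt
EvenIdxEven-∷ₚ (suc x) [] p = p
EvenIdxEven-∷ₚ x (y ∷ ys) p = p

mutual
  OddIdxEven-fromDiffs : ∀ cs → OddIdxEven (suffixSums cs) → OddIdxEven (fromDiffs cs)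
  OddIdxEven-fromDiffs [] p = p
  OddIdxEven-fromDiffs (c ∷ cs) (2∣x , p) = subst OddIdxEven (sym (fromDiffs-∷ c cs))
    (OddIdxEven-∷ₚ (c + sum cs) (fromDiffs cs) (2∣x , EvenIdxEven-fromDiffs cs p))

  EvenIdxEven-fromDiffs : ∀ cs → EvenIdxEven (suffixSums cs) → EvenIdxEven (fromDiffs cs)
  EvenIdxEven-fromDiffs [] p = p
  EvenIdxEven-fromDiffs (c ∷ cs) p = subst EvenIdxEven (sym (fromDiffs-∷ c cs))
    (EvenIdxEven-∷ₚ (c + sum cs) (fromDiffs cs) (OddIdxEven-fromDiffs cs p))

∷ₚ-positive : ∀ {x} ys → 1 ≤ x → x ∷ₚ ys ≡ x ∷ ys
∷ₚ-positive (y ∷ ys) _ = refl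
∷ₚ-positive {suc x} [] _ = refl

IsPartition-∷ₚ : ∀ x ys → IsPartition ys → head₀ ys ≤ x → IsPartition (x ∷ₚ ys)
IsPartition-∷ₚ x (y ∷ ys) (dec , pos-∷ 1≤y pos) y≤x = dec-cons y≤x dec , pos-∷ (ℕₚ.≤-trans 1≤y y≤x) (pos-∷ 1≤y pos)
IsPartition-∷ₚ zero [] _ _ = dec-[] , pos-[]
IsPartition-∷ₚ (suc x) [] _ _ = dec-one _ , pos-∷ (s≤s z≤n) pos-[]

fromDiffs-isPartition : ∀ cs → IsPartition (fromDiffs cs)
fromDiffs-isPartition [] = dec-[] , pos-[]
fromDiffs-isPartition (c ∷ cs) = IsPartition-∷ₚ _ (fromDiffs cs) (fromDiffs-isPartition cs) (ℕₚ.m≤n+m _ c)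

head₀≤ : ∀ {x xs} → Decreasing (x ∷ xs) → head₀ xs ≤ x
head₀≤ (dec-one _) = z≤n
head₀≤ (dec-cons y≤x _) = y≤x

Decreasing-tail : ∀ {x xs} → Decreasing (x ∷ xs) → Decreasing xs
Decreasing-tail (dec-one _) = dec-[]
Decreasing-tail (dec-cons _ dec) = dec

IsPartition-tail : ∀ {x xs} → IsPartition (x ∷ xs) → IsPartition xs
IsPartition-tail (dec , pos-∷ _ pos) = Decreasing-tail dec , pos

fromDiffs-diffs : ∀ λs → IsPartition λs → fromDiffs (diffs λs) ≡ λs
fromDiffs-diffs [] _ = refl
fromDiffs-diffs (x ∷ xs) p@(dec , pos-∷ 1≤x _) = begin
  (x ∸ head₀ xs + head₀ (fromDiffs (diffs xs))) ∷ₚ fromDiffs (diffs xs)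
    ≡⟨ cong (λ ys → (x ∸ head₀ xs + head₀ ys) ∷ₚ ys) (fromDiffs-diffs xs (IsPartition-tail p)) ⟩
  (x ∸ head₀ xs + head₀ xs) ∷ₚ xs
    ≡⟨ cong (_∷ₚ xs) (ℕₚ.m∸n+n≡m (head₀≤ dec)) ⟩
  x ∷ₚ xs
    ≡⟨ ∷ₚ-positive xs 1≤x ⟩
  x ∷ xs ∎
  where open ≡-Reasoning

diffs-fromDiffs : ∀ cs → diffs (fromDiffs cs) ≡ dropTrailingZeros cs
diffs-fromDiffs [] = refl
diffs-fromDiffs (c ∷ cs) with fromDiffs cs | diffs-fromDiffs cs
... | [] | e rewrite sym e = diffs-single c
  where
  diffs-single : ∀ c → diffs ((c + 0) ∷ₚ []) ≡ c ∷ₚ []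
  diffs-single zero = refl
  diffs-single (suc c) = cong (λ v → suc v ∷ []) (ℕₚ.+-identityʳ c)
... | y ∷ ys | e rewrite sym e = cong (_∷ diffs (y ∷ ys)) (ℕₚ.m+n∸n≡m c y)

fromDiffs-++-zeros : ∀ cs k → fromDiffs (cs ++ replicate k 0) ≡ fromDiffs cs
fromDiffs-++-zeros [] zero = refl
fromDiffs-++-zeros [] (suc k) rewrite fromDiffs-++-zeros [] k = refl
fromDiffs-++-zeros (c ∷ cs) k rewrite fromDiffs-++-zeros cs k = refl

moment : ℕ → List ℕ → ℕ
moment i [] = 0
moment i (x ∷ xs) = i * x + moment (suc i) xs

moment-suc : ∀ i xs → moment (suc i) xs ≡ moment i xs + sum xs
moment-suc i [] = refl
moment-suc i (x ∷ xs) rewrite moment-suc (suc i) xs = lemma i x (moment (suc i) xs) (sum xs)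
  where
  lemma : ∀ i x m s → suc i * x + (m + s) ≡ i * x + m + (x + s)
  lemma = solve-∀

size-fromDiffs : ∀ cs → size (fromDiffs cs) ≡ moment 1 cs
size-fromDiffs cs = trans (cong (λ s → proj₂ (proj₂ s)) (Stats-fromDiffs cs)) (size-suffixSums cs)
  where
  size-suffixSums : ∀ cs → size (suffixSums cs) ≡ moment 1 cs
  size-suffixSums [] = refl
  size-suffixSums (c ∷ cs) rewrite size-suffixSums cs | moment-suc 1 cs = lemma c (sum cs) (moment 1 cs)
    where
    lemma : ∀ c s m → c + s + m ≡ 1 * c + (m + s)
    lemma = solve-∀

length-diffs : ∀ λs → length (diffs λs) ≡ length λs
length-diffs [] = refl
length-diffs (x ∷ xs) = cong suc (length-diffs xs)

length≤size : ∀ {λs} → AllPositive λs → length λs ≤ size λs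
length≤size pos-[] = z≤n
length≤size (pos-∷ 1≤x pos) = ℕₚ.+-mono-≤ 1≤x (length≤size pos)

moment-bound : ∀ i xs → All (_≤ moment (suc i) xs) xs
moment-bound i [] = []
moment-bound i (x ∷ xs) =
  ℕₚ.≤-trans (ℕₚ.m≤n*m x (suc i)) (ℕₚ.m≤m+n _ _) ∷ All.map (λ x≤ → ℕₚ.≤-trans x≤ (ℕₚ.m≤n+m _ _)) (moment-bound (suc i) xs)

-- Pair layouts of difference sequences

bit : Bool → ℕ
bit false = 0
bit true = 1

ones : List Bool → ℕ
ones βs = sum (map bit βs)

-- Multiplicities missing from xs count as 0.
layout₂ : List Bool → List ℕ → List ℕ
layout₂ [] xs = map (2 *_) xs
layout₂ (β ∷ βs) xs = (2 * head₀ xs + bit β) ∷ (2 * head₀ (tail₀ xs) + bit β) ∷ layout₂ βs (tail₀ (tail₀ xs))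

layout₁ : List Bool → List ℕ → List ℕ
layout₁ [] xs = map (2 *_) xs
layout₁ (β ∷ βs) xs = (2 * head₀ xs + bit β) ∷ layout₂ βs (tail₀ xs)

isOdd-even : ∀ {n} → 2 ∣ n → isOdd n ≡ 0
isOdd-even {n} = n∣m⇒m%n≡0 n 2

isOdd-2*+bit+even : ∀ x β {s} → 2 ∣ s → isOdd (2 * x + bit β + s) ≡ bit β
isOdd-2*+bit+even x β (divides q refl) =
  trans (cong isOdd (regroup x (bit β) q)) (trans ([m+kn]%n≡m%n (bit β) (x + q) 2) (bit%2 β))
  where
  regroup : ∀ x b q → 2 * x + b + q * 2 ≡ b + (x + q) * 2
  regroup = solve-∀
  bit%2 : ∀ β → isOdd (bit β) ≡ bit β
  bit%2 false = refl
  bit%2 true = refl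

sum-map-2* : ∀ xs → sum (map (2 *_) xs) ≡ 2 * sum xs
sum-map-2* [] = refl
sum-map-2* (x ∷ xs) = trans (cong (_+_ (2 * x)) (sum-map-2* xs)) (sym (ℕₚ.*-distribˡ-+ 2 x (sum xs)))

sum-layout₂-even : ∀ βs xs → 2 ∣ sum (layout₂ βs xs)
sum-layout₂-even [] xs = subst (2 ∣_) (sym (sum-map-2* xs)) (m∣m*n (sum xs))
sum-layout₂-even (β ∷ βs) xs =
  subst (2 ∣_) (regroup (head₀ xs) (head₀ (tail₀ xs)) (bit β) (sum (layout₂ βs (tail₀ (tail₀ xs)))))
    (∣m∣n⇒∣m+n (m∣m*n (head₀ xs + head₀ (tail₀ xs) + bit β)) (sum-layout₂-even βs (tail₀ (tail₀ xs))))
  where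
  regroup : ∀ x y b s → 2 * (x + y + b) + s ≡ 2 * x + b + (2 * y + b + s)
  regroup = solve-∀

AllEven : List ℕ → Set
AllEven = All (2 ∣_)

AllEven-parity : ∀ {R} → AllEven R →
  OddIdxEven R × EvenIdxEven R × oddsAtOddIdx R ≡ 0 × oddsAtEvenIdx R ≡ 0
AllEven-parity [] = tt , tt , refl , refl
AllEven-parity (2∣r ∷ evens) =
  let (odd , even , nOdd , nEven) = AllEven-parity evens in
  (2∣r , even) , odd , cong₂ _+_ (isOdd-even 2∣r) nEven , nOdd

suffixSums-doubled : ∀ xs → AllEven (suffixSums (map (2 *_) xs))
suffixSums-doubled [] = []
suffixSums-doubled (x ∷ xs) = subst (2 ∣_) (sym (sum-map-2* (x ∷ xs))) (m∣m*n (sum (x ∷ xs))) ∷ suffixSums-doubled xs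

suffixSums-layout₂ : ∀ βs xs →
  OddIdxEven (suffixSums (layout₂ βs xs))
  × oddsAtOddIdx (suffixSums (layout₂ βs xs)) ≡ 0
  × oddsAtEvenIdx (suffixSums (layout₂ βs xs)) ≡ ones βs
suffixSums-layout₂ [] xs = let (odd , _ , nOdd , nEven) = AllEven-parity (suffixSums-doubled xs) in odd , nOdd , nEven
suffixSums-layout₂ (β ∷ βs) xs =
  let (odd , nOdd , nEven) = suffixSums-layout₂ βs (tail₀ (tail₀ xs)) in
  (2∣first , odd) , cong₂ _+_ (isOdd-even 2∣first) nOdd ,
  cong₂ _+_ (isOdd-2*+bit+even (head₀ (tail₀ xs)) β (sum-layout₂-even βs (tail₀ (tail₀ xs)))) nEven
  where
  2∣first : 2 ∣ sum (layout₂ (β ∷ βs) xs)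
  2∣first = sum-layout₂-even (β ∷ βs) xs

suffixSums-layout₁ : ∀ βs xs →
  EvenIdxEven (suffixSums (layout₁ βs xs))
  × oddsAtOddIdx (suffixSums (layout₁ βs xs)) ≡ ones βs
  × oddsAtEvenIdx (suffixSums (layout₁ βs xs)) ≡ 0
suffixSums-layout₁ [] xs = let (_ , even , nOdd , nEven) = AllEven-parity (suffixSums-doubled xs) in even , nOdd , nEven
suffixSums-layout₁ (β ∷ βs) xs =
  let (odd , nOdd , nEven) = suffixSums-layout₂ βs (tail₀ xs) in
  odd , cong₂ _+_ (isOdd-2*+bit+even (head₀ xs) β (sum-layout₂-even βs (tail₀ xs))) nEven , nOdd

inP₂-layout₂ : ∀ βs xs → InP2 (fromDiffs (layout₂ βs xs))
inP₂-layout₂ βs xs = OddIdxEven-fromDiffs (layout₂ βs xs) (proj₁ (suffixSums-layout₂ βs xs))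

inP₁-layout₁ : ∀ βs xs → InP1 (fromDiffs (layout₁ βs xs))
inP₁-layout₁ βs xs = EvenIdxEven-fromDiffs (layout₁ βs xs) (proj₁ (suffixSums-layout₁ βs xs))

BG-fromDiffs : ∀ cs → BG (fromDiffs cs) ≡ + oddsAtOddIdx (suffixSums cs) ℤ.- + oddsAtEvenIdx (suffixSums cs)
BG-fromDiffs cs = cong (λ s → + proj₁ s ℤ.- + proj₁ (proj₂ s)) (Stats-fromDiffs cs)

BG-layout₂ : ∀ βs xs → BG (fromDiffs (layout₂ βs xs)) ≡ ℤ.- + ones βs
BG-layout₂ βs xs = let (_ , nOdd , nEven) = suffixSums-layout₂ βs xs in
  trans (BG-fromDiffs (layout₂ βs xs)) (trans (cong₂ (λ o e → + o ℤ.- + e) nOdd nEven) (ℤₚ.+-identityˡ _))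

BG-layout₁ : ∀ βs xs → BG (fromDiffs (layout₁ βs xs)) ≡ + ones βs
BG-layout₁ βs xs = let (_ , nOdd , nEven) = suffixSums-layout₁ βs xs in
  trans (BG-fromDiffs (layout₁ βs xs)) (trans (cong₂ (λ o e → + o ℤ.- + e) nOdd nEven) (ℤₚ.+-identityʳ _))

moment-tail₀ : ∀ i xs → moment i xs ≡ i * head₀ xs + moment (suc i) (tail₀ xs)
moment-tail₀ i [] = sym (trans (ℕₚ.+-identityʳ _) (ℕₚ.*-zeroʳ i))
moment-tail₀ i (x ∷ xs) = refl

moment-doubled : ∀ i xs → moment i (map (2 *_) xs) ≡ 2 * moment i xs
moment-doubled i [] = refl
moment-doubled i (x ∷ xs) rewrite moment-doubled (suc i) xs = lemma i x (moment (suc i) xs)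
  where
  lemma : ∀ i x m → i * (2 * x) + 2 * m ≡ 2 * (i * x + m)
  lemma = solve-∀

moment-layout₂ : ∀ p βs xs →
  moment (suc p) (layout₂ βs xs) ≡ 2 * moment (suc p) xs + ((2 * p + 3) * ones βs + 4 * moment 0 (map bit βs))
moment-layout₂ p [] xs = trans (moment-doubled (suc p) xs) (sym (lemma (2 * moment (suc p) xs) p))
  where
  lemma : ∀ m p → m + ((2 * p + 3) * 0 + 4 * 0) ≡ m
  lemma = solve-∀
moment-layout₂ p (β ∷ βs) xs
  rewrite moment-layout₂ (suc (suc p)) βs (tail₀ (tail₀ xs)) | moment-tail₀ (suc p) xs | moment-tail₀ (suc (suc p)) (tail₀ xs)
        | moment-suc 0 (map bit βs) =
  lemma p (head₀ xs) (head₀ (tail₀ xs)) (bit β) (moment (suc (suc (suc p))) (tail₀ (tail₀ xs))) (ones βs) (moment 0 (map bit βs))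
  where
  lemma : ∀ p x y b m t i →
    suc p * (2 * x + b) + (suc (suc p) * (2 * y + b) + (2 * m + ((2 * suc (suc p) + 3) * t + 4 * i)))
    ≡ 2 * (suc p * x + (suc (suc p) * y + m)) + ((2 * p + 3) * (b + t) + 4 * (0 * b + (i + t)))
  lemma = solve-∀

size-layout₂ : ∀ βs xs → size (fromDiffs (layout₂ βs xs)) ≡ 2 * moment 1 xs + (3 * ones βs + 4 * moment 0 (map bit βs))
size-layout₂ βs xs = trans (size-fromDiffs (layout₂ βs xs)) (moment-layout₂ 0 βs xs)

size-layout₁ : ∀ βs xs → size (fromDiffs (layout₁ βs xs)) ≡ 2 * moment 1 xs + (1 * ones βs + 4 * moment 0 (map bit βs))
size-layout₁ βs xs = trans (size-fromDiffs (layout₁ βs xs)) (moment-layout₁ βs xs)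
  where
  moment-layout₁ : ∀ βs xs → moment 1 (layout₁ βs xs) ≡ 2 * moment 1 xs + (1 * ones βs + 4 * moment 0 (map bit βs))
  moment-layout₁ [] xs = moment-layout₂ 0 [] xs
  moment-layout₁ (β ∷ βs) xs rewrite moment-layout₂ 1 βs (tail₀ xs) | moment-tail₀ 1 xs | moment-suc 0 (map bit βs) =
    lemma (head₀ xs) (bit β) (moment 2 (tail₀ xs)) (ones βs) (moment 0 (map bit βs))
    where
    lemma : ∀ x b m t i →
      1 * (2 * x + b) + (2 * m + ((2 * 1 + 3) * t + 4 * i)) ≡ 2 * (1 * x + m) + (1 * (b + t) + 4 * (0 * b + (i + t)))
    lemma = solve-∀

parity : ℕ → Bool
parity zero = false
parity (suc zero) = true
parity (suc (suc n)) = parity n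

half-parity : ∀ c → 2 * ⌊ c /2⌋ + bit (parity c) ≡ c
half-parity zero = refl
half-parity (suc zero) = refl
half-parity (suc (suc c)) = trans (lemma ⌊ c /2⌋ (bit (parity c))) (cong (λ v → suc (suc v)) (half-parity c))
  where
  lemma : ∀ h b → 2 * suc h + b ≡ suc (suc (2 * h + b))
  lemma = solve-∀

half-2*+bit : ∀ x β → ⌊ 2 * x + bit β /2⌋ ≡ x
half-2*+bit zero false = refl
half-2*+bit zero true = refl
half-2*+bit (suc x) β rewrite ℕₚ.+-suc x (x + 0) = cong suc (half-2*+bit x β)

parity-2*+bit : ∀ x β → parity (2 * x + bit β) ≡ β
parity-2*+bit zero false = refl
parity-2*+bit zero true = refl
parity-2*+bit (suc x) β rewrite ℕₚ.+-suc x (x + 0) = parity-2*+bit x β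

half-2* : ∀ x → ⌊ 2 * x /2⌋ ≡ x
half-2* x = trans (cong ⌊_/2⌋ (sym (ℕₚ.+-identityʳ (2 * x)))) (half-2*+bit x false)

parity-2* : ∀ x → parity (2 * x) ≡ false
parity-2* x = trans (cong parity (sym (ℕₚ.+-identityʳ (2 * x)))) (parity-2*+bit x false)

parity-suc : ∀ n → parity (suc n) ≡ not (parity n)
parity-suc zero = refl
parity-suc (suc zero) = refl
parity-suc (suc (suc n)) = parity-suc n

parity-+even : ∀ m {n} → parity n ≡ false → parity (m + n) ≡ parity m
parity-+even zero n-even = n-even
parity-+even (suc zero) {n} n-even = trans (parity-suc n) (cong not n-even)
parity-+even (suc (suc m)) n-even = parity-+even m n-even

parity-equal : ∀ a b → parity (a + b) ≡ false → parity a ≡ parity b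
parity-equal zero b sum-even = sym sum-even
parity-equal (suc zero) b sum-even with parity b | parity-suc b
... | true | _ = refl
... | false | p = contradiction (trans (sym p) sum-even) λ ()
parity-equal (suc (suc a)) b sum-even = parity-equal a b sum-even

parity-even : ∀ {n} → 2 ∣ n → parity n ≡ false
parity-even (divides q refl) = parity-*2 q
  where
  parity-*2 : ∀ q → parity (q * 2) ≡ false
  parity-*2 zero = refl
  parity-*2 (suc q) = parity-*2 q

2*+bit-injective : ∀ x β x′ β′ → 2 * x + bit β ≡ 2 * x′ + bit β′ → x ≡ x′ × β ≡ β′
2*+bit-injective x β x′ β′ eq =
  trans (sym (half-2*+bit x β)) (trans (cong ⌊_/2⌋ eq) (half-2*+bit x′ β′)) ,
  trans (sym (parity-2*+bit x β)) (trans (cong parity eq) (parity-2*+bit x′ β′))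

infix 4 _≈₀_

_≈₀_ : List ℕ → List ℕ → Set
c ≈₀ d = ∃[ r ] c ≡ d ++ replicate r 0

fromDiffs-≈₀ : ∀ {c d} → c ≈₀ d → fromDiffs c ≡ fromDiffs d
fromDiffs-≈₀ {d = d} (r , refl) = fromDiffs-++-zeros d r

≈₀-refl : ∀ {c} → c ≈₀ c
≈₀-refl = 0 , sym (++-identityʳ _)

∷-≈₀ : ∀ x {c d} → c ≈₀ d → x ∷ c ≈₀ x ∷ d
∷-≈₀ x (r , eq) = r , cong (x ∷_) eq

≈₀-trans : ∀ {c d e} → c ≈₀ d → d ≈₀ e → c ≈₀ e
≈₀-trans {e = e} (r , refl) (s , refl) = s + r , trans (++-assoc e _ _) (cong (e ++_) (replicate-++ s r))
  where
  replicate-++ : ∀ s r → replicate s 0 ++ replicate r 0 ≡ replicate (s + r) 0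
  replicate-++ zero r = refl
  replicate-++ (suc s) r = cong (0 ∷_) (replicate-++ s r)

≈₀-dropTrailingZeros : ∀ c → c ≈₀ dropTrailingZeros c
≈₀-dropTrailingZeros [] = ≈₀-refl
≈₀-dropTrailingZeros (c ∷ cs) with dropTrailingZeros cs | ≈₀-dropTrailingZeros cs
... | y ∷ ys | pad = ∷-≈₀ c pad
≈₀-dropTrailingZeros (zero ∷ cs) | [] | (r , eq) = suc r , cong (0 ∷_) eq
≈₀-dropTrailingZeros (suc c ∷ cs) | [] | pad = ∷-≈₀ (suc c) pad

dropTrailingZeros-injective : ∀ c c′ → dropTrailingZeros c ≡ dropTrailingZeros c′ → length c ≡ length c′ → c ≡ c′
dropTrailingZeros-injective c c′ eq len with ≈₀-dropTrailingZeros c | ≈₀-dropTrailingZeros c′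
... | r , c≡ | r′ , c′≡ rewrite eq = trans c≡ (trans (cong (λ n → d ++ replicate n 0) r≡r′) (sym c′≡))
  where
  d = dropTrailingZeros c′
  r≡r′ : r ≡ r′
  r≡r′ = ℕₚ.+-cancelˡ-≡ (length d) r r′ (begin
    length d + r                       ≡⟨ cong (_+_ (length d)) (sym (length-replicate r)) ⟩
    length d + length (replicate r 0)  ≡⟨ sym (length-++ d) ⟩
    length (d ++ replicate r 0)        ≡⟨ cong length (sym c≡) ⟩
    length c                           ≡⟨ len ⟩
    length c′                          ≡⟨ cong length c′≡ ⟩
    length (d ++ replicate r′ 0)       ≡⟨ length-++ d ⟩
    length d + length (replicate r′ 0) ≡⟨ cong (_+_ (length d)) (length-replicate r′) ⟩
    length d + r′                      ∎)
    where open ≡-Reasoning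

doubled-++-zeros : ∀ xs b → map (2 *_) (xs ++ replicate b 0) ≈₀ map (2 *_) xs
doubled-++-zeros xs b = b , trans (map-++ (2 *_) xs _) (cong (map (2 *_) xs ++_) (map-replicate (2 *_) b 0))

layout₂-falses : ∀ a ys → layout₂ (replicate a false) ys ≈₀ map (2 *_) ys
layout₂-falses zero ys = ≈₀-refl
layout₂-falses (suc a) [] = let (r , eq) = layout₂-falses a [] in suc (suc r) , cong (λ c → 0 ∷ 0 ∷ c) eq
layout₂-falses (suc a) (y ∷ []) = let (r , eq) = layout₂-falses a [] in
  suc r , cong₂ (λ u c → u ∷ 0 ∷ c) (ℕₚ.+-identityʳ _) eq
layout₂-falses (suc a) (y ∷ y′ ∷ ys) rewrite ℕₚ.+-identityʳ (2 * y) | ℕₚ.+-identityʳ (2 * y′) =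
  ∷-≈₀ (2 * y) (∷-≈₀ (2 * y′) (layout₂-falses a ys))

layout₁-falses : ∀ a ys → layout₁ (replicate a false) ys ≈₀ map (2 *_) ys
layout₁-falses zero ys = ≈₀-refl
layout₁-falses (suc a) [] = let (r , eq) = layout₂-falses a [] in suc r , cong (0 ∷_) eq
layout₁-falses (suc a) (y ∷ ys) rewrite ℕₚ.+-identityʳ (2 * y) = ∷-≈₀ (2 * y) (layout₂-falses a ys)

2*suc : ∀ l → 2 * suc l ≡ suc (suc (2 * l))
2*suc = solve-∀

2*suc≤2+⇒ : ∀ l {n} → 2 * suc l ≤ suc (suc n) → 2 * l ≤ n
2*suc≤2+⇒ l {n} le = ℕₚ.≤-pred (ℕₚ.≤-pred (subst (_≤ suc (suc n)) (2*suc l) le))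

2*suc≰1 : ∀ l → ¬ 2 * suc l ≤ 1
2*suc≰1 l le with subst (_≤ 1) (2*suc l) le
... | s≤s ()

layout₂-padding : ∀ βs xs a b → 2 * length βs ≤ length xs →
  layout₂ (βs ++ replicate a false) (xs ++ replicate b 0) ≈₀ layout₂ βs xs
layout₂-padding [] xs a b _ = ≈₀-trans (layout₂-falses a (xs ++ replicate b 0)) (doubled-++-zeros xs b)
layout₂-padding (β ∷ βs) (x ∷ y ∷ xs) a b le = ∷-≈₀ _ (∷-≈₀ _ (layout₂-padding βs xs a b (2*suc≤2+⇒ (length βs) le)))
layout₂-padding (β ∷ βs) [] a b le = contradiction (ℕₚ.≤-trans le z≤n) (2*suc≰1 (length βs))
layout₂-padding (β ∷ βs) (x ∷ []) a b le = contradiction le (2*suc≰1 (length βs))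

layout₁-padding : ∀ βs xs a b → 2 * length βs ≤ length xs →
  layout₁ (βs ++ replicate a false) (xs ++ replicate b 0) ≈₀ layout₁ βs xs
layout₁-padding [] xs a b _ = ≈₀-trans (layout₁-falses a (xs ++ replicate b 0)) (doubled-++-zeros xs b)
layout₁-padding (β ∷ βs) (x ∷ xs) a b le =
  ∷-≈₀ _ (layout₂-padding βs xs a b (ℕₚ.≤-trans (ℕₚ.n≤1+n _) (ℕₚ.≤-pred (subst (_≤ suc (length xs)) (2*suc (length βs)) le))))
layout₁-padding (β ∷ βs) [] a b le = contradiction (ℕₚ.≤-trans le z≤n) (2*suc≰1 (length βs))

length-tail₀ : ∀ xs → length (tail₀ xs) ≡ ℕ.pred (length xs)
length-tail₀ [] = refl
length-tail₀ (x ∷ xs) = refl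

head₀-tail₀-injective : ∀ {xs xs′} → length xs ≡ length xs′ → head₀ xs ≡ head₀ xs′ → tail₀ xs ≡ tail₀ xs′ → xs ≡ xs′
head₀-tail₀-injective {[]} {[]} _ _ _ = refl
head₀-tail₀-injective {x ∷ xs} {x′ ∷ xs′} _ h t = cong₂ _∷_ h t

length-tail₀-cong : ∀ xs xs′ → length xs ≡ length xs′ → length (tail₀ xs) ≡ length (tail₀ xs′)
length-tail₀-cong xs xs′ len = trans (length-tail₀ xs) (trans (cong ℕ.pred len) (sym (length-tail₀ xs′)))

doubled-injective : ∀ xs xs′ → map (2 *_) xs ≡ map (2 *_) xs′ → xs ≡ xs′
doubled-injective xs xs′ = map-injective (ℕₚ.*-cancelˡ-≡ _ _ 2)

layout₂-injective : ∀ βs βs′ xs xs′ → length βs ≡ length βs′ → length xs ≡ length xs′ →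
  layout₂ βs xs ≡ layout₂ βs′ xs′ → βs ≡ βs′ × xs ≡ xs′
layout₂-injective [] [] xs xs′ _ _ eq = refl , doubled-injective xs xs′ eq
layout₂-injective (β ∷ βs) (β′ ∷ βs′) xs xs′ lenβ lenx eq =
  let (eq₁ , eq′) = ∷-injective eq
      (eq₂ , eq-rest) = ∷-injective eq′
      (x≡ , β≡) = 2*+bit-injective _ β _ β′ eq₁
      (y≡ , _) = 2*+bit-injective _ β _ β′ eq₂
      lenx₁ = length-tail₀-cong xs xs′ lenx
      (βs≡ , rest≡) = layout₂-injective βs βs′ _ _ (ℕₚ.suc-injective lenβ)
                        (length-tail₀-cong (tail₀ xs) (tail₀ xs′) lenx₁) eq-rest
  in cong₂ _∷_ β≡ βs≡ , head₀-tail₀-injective lenx x≡ (head₀-tail₀-injective lenx₁ y≡ rest≡)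

layout₁-injective : ∀ βs βs′ xs xs′ → length βs ≡ length βs′ → length xs ≡ length xs′ →
  layout₁ βs xs ≡ layout₁ βs′ xs′ → βs ≡ βs′ × xs ≡ xs′
layout₁-injective [] [] xs xs′ _ _ eq = refl , doubled-injective xs xs′ eq
layout₁-injective (β ∷ βs) (β′ ∷ βs′) xs xs′ lenβ lenx eq =
  let (eq₁ , eq-rest) = ∷-injective eq
      (x≡ , β≡) = 2*+bit-injective _ β _ β′ eq₁
      (βs≡ , rest≡) = layout₂-injective βs βs′ _ _ (ℕₚ.suc-injective lenβ) (length-tail₀-cong xs xs′ lenx) eq-rest
  in cong₂ _∷_ β≡ βs≡ , head₀-tail₀-injective lenx x≡ rest≡

length-layout₂-cong : ∀ βs βs′ xs xs′ → length βs ≡ length βs′ → length xs ≡ length xs′ →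
  length (layout₂ βs xs) ≡ length (layout₂ βs′ xs′)
length-layout₂-cong [] [] xs xs′ _ lenx = trans (length-map _ xs) (trans lenx (sym (length-map _ xs′)))
length-layout₂-cong (_ ∷ βs) (_ ∷ βs′) xs xs′ lenβ lenx =
  cong (λ n → suc (suc n)) (length-layout₂-cong βs βs′ _ _ (ℕₚ.suc-injective lenβ)
    (length-tail₀-cong (tail₀ xs) (tail₀ xs′) (length-tail₀-cong xs xs′ lenx)))

length-layout₁-cong : ∀ βs βs′ xs xs′ → length βs ≡ length βs′ → length xs ≡ length xs′ →
  length (layout₁ βs xs) ≡ length (layout₁ βs′ xs′)
length-layout₁-cong [] [] xs xs′ _ lenx = trans (length-map _ xs) (trans lenx (sym (length-map _ xs′)))
length-layout₁-cong (_ ∷ βs) (_ ∷ βs′) xs xs′ lenβ lenx =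
  cong suc (length-layout₂-cong βs βs′ _ _ (ℕₚ.suc-injective lenβ) (length-tail₀-cong xs xs′ lenx))

-- Terms of the double sums and their decoding

cong₃ : ∀ {A B C D : Set} (f : A → B → C → D) {a a′ b b′ c c′} → a ≡ a′ → b ≡ b′ → c ≡ c′ → f a b c ≡ f a′ b′ c′
cong₃ f refl refl refl = refl

-- even t bs ms is a monomial of the n-th summand of the first sum, n = 1 + length bs: t and bs
-- choose from the n factors of (a;q⁴)_n and ms are the exponents from 1/(q²;q²)_{2n}; odd bs ms
-- is the same for the second sum, and empty is its summand n = 0.
data Term : Set where
  empty : Term
  even : Bool → List Bool → List ℕ → Term
  odd : List Bool → List ℕ → Term

WellShaped : Term → Set
WellShaped empty = ⊤
WellShaped (even t bs ms) = length ms ≡ 2 * suc (length bs)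
WellShaped (odd bs ms) = length ms ≡ suc (2 * length bs)

incLast : List ℕ → List ℕ
incLast [] = []
incLast (x ∷ []) = suc x ∷ []
incLast (x ∷ ms@(_ ∷ _)) = x ∷ incLast ms

adjustLast : Bool → List ℕ → List ℕ
adjustLast true ms = ms
adjustLast false ms = incLast ms

-- The factor q^{4n} is absorbed either by the first factor of (a;q⁴)_n, which becomes the last
-- pair of the layout (t = true), or by raising the last exponent, that of q^{2·2n}, by one
-- (t = false); likewise q^{4n+2} raises the exponent of q^{2(2n+1)} in the second sum.
columns : Term → List Bool × List ℕ
columns empty = [] , []
columns (even t bs ms) = bs ∷ʳ t , adjustLast t ms
columns (odd bs ms) = bs , incLast ms

prepend : Bool → List ℕ → Term → Term
prepend b xs empty = empty
prepend b xs (even t bs ms) = even t (b ∷ bs) (xs ++ ms)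
prepend b xs (odd bs ms) = odd (b ∷ bs) (xs ++ ms)

unadjustLast : Bool → ℕ → ℕ
unadjustLast t d = if t then ⌊ d /2⌋ else pred ⌊ d /2⌋

decode₂ : List ℕ → Term
decode₂ [] = empty
decode₂ (c ∷ []) = odd [] (pred ⌊ c /2⌋ ∷ [])
decode₂ (c ∷ d ∷ []) = even (parity c) [] (⌊ c /2⌋ ∷ unadjustLast (parity c) d ∷ [])
decode₂ (c ∷ d ∷ cs@(_ ∷ _)) = prepend (parity c) (⌊ c /2⌋ ∷ ⌊ d /2⌋ ∷ []) (decode₂ cs)

decode₁-tail : ℕ → ℕ → List ℕ → Term
decode₁-tail d e [] =
  if parity d then even true [] (⌊ d /2⌋ ∷ ⌊ e /2⌋ ∷ 0 ∷ []) else odd [] (⌊ d /2⌋ ∷ pred ⌊ e /2⌋ ∷ [])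
decode₁-tail d e (f ∷ []) = even (parity d) [] (⌊ d /2⌋ ∷ ⌊ e /2⌋ ∷ unadjustLast (parity d) f ∷ [])
decode₁-tail d e (f ∷ g ∷ cs) = prepend (parity d) (⌊ d /2⌋ ∷ ⌊ e /2⌋ ∷ []) (decode₁-tail f g cs)

decode₁ : List ℕ → Term
decode₁ [] = empty
decode₁ (c ∷ []) = if parity c then even true [] (⌊ c /2⌋ ∷ 0 ∷ []) else odd [] (pred ⌊ c /2⌋ ∷ [])
decode₁ (c ∷ d ∷ []) = even (parity c) [] (⌊ c /2⌋ ∷ unadjustLast (parity c) d ∷ [])
decode₁ (c ∷ d ∷ e ∷ cs) = prepend (parity c) (⌊ c /2⌋ ∷ []) (decode₁-tail d e cs)

TailShaped : Term → Set
TailShaped empty = ⊥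
TailShaped (even t bs ms) = length ms ≡ suc (2 * suc (length bs))
TailShaped (odd bs ms) = length ms ≡ 2 * suc (length bs)

prepend-wellShaped : ∀ b x y s → WellShaped s → WellShaped (prepend b (x ∷ y ∷ []) s)
prepend-wellShaped b x y empty _ = tt
prepend-wellShaped b x y (even t bs ms) len = trans (cong (λ n → suc (suc n)) len) (sym (2*suc (suc (length bs))))
prepend-wellShaped b x y (odd bs ms) len = cong suc (trans (cong suc len) (sym (2*suc (length bs))))

prepend-tailShaped : ∀ b x y s → TailShaped s → TailShaped (prepend b (x ∷ y ∷ []) s)
prepend-tailShaped b x y (even t bs ms) len = trans (cong (λ n → suc (suc n)) len) (cong suc (sym (2*suc (suc (length bs)))))
prepend-tailShaped b x y (odd bs ms) len = trans (cong (λ n → suc (suc n)) len) (sym (2*suc (suc (length bs))))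

prepend-tail-wellShaped : ∀ b x s → TailShaped s → WellShaped (prepend b (x ∷ []) s)
prepend-tail-wellShaped b x (even t bs ms) len = trans (cong suc len) (sym (2*suc (suc (length bs))))
prepend-tail-wellShaped b x (odd bs ms) len = cong suc len

decode₂-wellShaped : ∀ c → WellShaped (decode₂ c)
decode₂-wellShaped [] = tt
decode₂-wellShaped (c ∷ []) = refl
decode₂-wellShaped (c ∷ d ∷ []) = refl
decode₂-wellShaped (c ∷ d ∷ cs@(_ ∷ _)) = prepend-wellShaped _ _ _ (decode₂ cs) (decode₂-wellShaped cs)

decode₁-tail-tailShaped : ∀ d e cs → TailShaped (decode₁-tail d e cs)
decode₁-tail-tailShaped d e [] with parity d
... | true = refl
... | false = refl
decode₁-tail-tailShaped d e (f ∷ []) = refl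
decode₁-tail-tailShaped d e (f ∷ g ∷ cs) = prepend-tailShaped _ _ _ (decode₁-tail f g cs) (decode₁-tail-tailShaped f g cs)

decode₁-wellShaped : ∀ c → WellShaped (decode₁ c)
decode₁-wellShaped [] = tt
decode₁-wellShaped (c ∷ []) with parity c
... | true = refl
... | false = refl
decode₁-wellShaped (c ∷ d ∷ []) = refl
decode₁-wellShaped (c ∷ d ∷ e ∷ cs) = prepend-tail-wellShaped _ _ (decode₁-tail d e cs) (decode₁-tail-tailShaped d e cs)

LastPositive : List ℕ → Set
LastPositive [] = ⊤
LastPositive (c ∷ []) = 1 ≤ c
LastPositive (c ∷ cs@(_ ∷ _)) = LastPositive cs

Paired₂ : List ℕ → Set
Paired₂ [] = ⊤
Paired₂ (c ∷ []) = parity c ≡ false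
Paired₂ (c ∷ d ∷ cs) = parity c ≡ parity d × Paired₂ cs

Paired₁ : List ℕ → Set
Paired₁ [] = ⊤
Paired₁ (c ∷ cs) = Paired₂ cs

twice-half-of-odd : ∀ c → parity c ≡ true → 2 * ⌊ c /2⌋ + 1 ≡ c
twice-half-of-odd c c-odd = subst (λ b → 2 * ⌊ c /2⌋ + bit b ≡ c) c-odd (half-parity c)

twice-half-of-even : ∀ c → parity c ≡ false → 2 * ⌊ c /2⌋ ≡ c
twice-half-of-even c c-even = trans (sym (ℕₚ.+-identityʳ _)) (subst (λ b → 2 * ⌊ c /2⌋ + bit b ≡ c) c-even (half-parity c))

twice-half-of-even-positive : ∀ c → parity c ≡ false → 1 ≤ c → 2 * suc (pred ⌊ c /2⌋) ≡ c
twice-half-of-even-positive c c-even 1≤c with ⌊ c /2⌋ | twice-half-of-even c c-even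
... | zero | refl = contradiction 1≤c λ ()
... | suc h | eq = eq

twice-half-in-pair : ∀ c d → parity c ≡ parity d → 2 * ⌊ d /2⌋ + bit (parity c) ≡ d
twice-half-in-pair c d same = trans (cong (λ b → 2 * ⌊ d /2⌋ + bit b) same) (half-parity d)

incLast-++ : ∀ xs m ms → incLast (xs ++ m ∷ ms) ≡ xs ++ incLast (m ∷ ms)
incLast-++ [] m ms = refl
incLast-++ (x ∷ []) m ms = refl
incLast-++ (x ∷ x′ ∷ xs) m ms = cong (x ∷_) (incLast-++ (x′ ∷ xs) m ms)

adjustLast-++ : ∀ t xs m ms → adjustLast t (xs ++ m ∷ ms) ≡ xs ++ adjustLast t (m ∷ ms)
adjustLast-++ true xs m ms = refl
adjustLast-++ false xs m ms = incLast-++ xs m ms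

length-incLast : ∀ ms → length (incLast ms) ≡ length ms
length-incLast [] = refl
length-incLast (x ∷ []) = refl
length-incLast (x ∷ ms@(_ ∷ _)) = cong suc (length-incLast ms)

All-incLast⁻ : ∀ {B} ms → All (_≤ B) (incLast ms) → All (_≤ B) ms
All-incLast⁻ [] [] = []
All-incLast⁻ (x ∷ []) (sx≤B ∷ []) = ℕₚ.≤-trans (ℕₚ.n≤1+n x) sx≤B ∷ []
All-incLast⁻ (x ∷ ms@(_ ∷ _)) (x≤B ∷ rest) = x≤B ∷ All-incLast⁻ ms rest

length-adjustLast : ∀ t ms → length (adjustLast t ms) ≡ length ms
length-adjustLast true ms = refl
length-adjustLast false ms = length-incLast ms

All-adjustLast⁻ : ∀ {B} t ms → All (_≤ B) (adjustLast t ms) → All (_≤ B) ms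
All-adjustLast⁻ true ms all = all
All-adjustLast⁻ false ms all = All-incLast⁻ ms all

Proper : Term → Set
Proper empty = ⊥
Proper (even _ _ []) = ⊥
Proper (even _ _ (_ ∷ _)) = ⊤
Proper (odd _ []) = ⊥
Proper (odd _ (_ ∷ _)) = ⊤

columns-prepend : ∀ b xs s → Proper s → columns (prepend b xs s) ≡ (b ∷ proj₁ (columns s) , xs ++ proj₂ (columns s))
columns-prepend b xs (even t bs (m ∷ ms)) _ = cong (b ∷ bs ∷ʳ t ,_) (adjustLast-++ t xs m ms)
columns-prepend b xs (odd bs (m ∷ ms)) _ = cong (b ∷ bs ,_) (incLast-++ xs m ms)

prepend-proper : ∀ b x xs s → Proper s → Proper (prepend b (x ∷ xs) s)
prepend-proper b x xs (even t bs (m ∷ ms)) _ = tt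
prepend-proper b x xs (odd bs (m ∷ ms)) _ = tt

decode₂-proper : ∀ c cs → Proper (decode₂ (c ∷ cs))
decode₂-proper c [] = tt
decode₂-proper c (d ∷ []) = tt
decode₂-proper c (d ∷ e ∷ cs) = prepend-proper _ _ _ (decode₂ (e ∷ cs)) (decode₂-proper e cs)

layout₂-decode₂ : ∀ c → Paired₂ c → LastPositive c → uncurry layout₂ (columns (decode₂ c)) ≡ c
layout₂-decode₂ [] _ _ = refl
layout₂-decode₂ (c ∷ []) c-even 1≤c = cong (_∷ []) (twice-half-of-even-positive c c-even 1≤c)
layout₂-decode₂ (c ∷ d ∷ []) (same , _) 1≤d with parity c in pc
... | true = cong₂ (λ u v → u ∷ v ∷ []) (twice-half-of-odd c pc) (twice-half-of-odd d (sym same))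
... | false = cong₂ (λ u v → u ∷ v ∷ [])
  (trans (ℕₚ.+-identityʳ _) (twice-half-of-even c pc)) (trans (ℕₚ.+-identityʳ _) (twice-half-of-even-positive d (sym same) 1≤d))
layout₂-decode₂ (c ∷ d ∷ cs@(e ∷ cs′)) (same , paired) pos = begin
  uncurry layout₂ (columns (prepend (parity c) (⌊ c /2⌋ ∷ ⌊ d /2⌋ ∷ []) (decode₂ cs)))
    ≡⟨ cong (uncurry layout₂) (columns-prepend _ _ (decode₂ cs) (decode₂-proper e cs′)) ⟩
  (2 * ⌊ c /2⌋ + bit (parity c)) ∷ (2 * ⌊ d /2⌋ + bit (parity c)) ∷ uncurry layout₂ (columns (decode₂ cs))
    ≡⟨ cong₂ _∷_ (half-parity c) (cong₂ _∷_ (twice-half-in-pair c d same) (layout₂-decode₂ cs paired pos)) ⟩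
  c ∷ d ∷ cs ∎
  where open ≡-Reasoning

dropTrailingZeros-lastPositive : ∀ c → LastPositive c → dropTrailingZeros c ≡ c
dropTrailingZeros-lastPositive [] _ = refl
dropTrailingZeros-lastPositive (suc c ∷ []) _ = refl
dropTrailingZeros-lastPositive (c ∷ cs@(_ ∷ _)) pos rewrite dropTrailingZeros-lastPositive cs pos = refl

decode₂-pair : ∀ x y b L {s} → decode₂ L ≡ s → Proper s → LastPositive L →
  decode₂ ((2 * x + bit b) ∷ (2 * y + bit b) ∷ L) ≡ prepend b (x ∷ y ∷ []) s
  × LastPositive ((2 * x + bit b) ∷ (2 * y + bit b) ∷ L)
decode₂-pair x y b [] refl () _
decode₂-pair x y b L@(_ ∷ _) refl _ pos =
  cong₂ (λ p h → prepend p h (decode₂ L)) (parity-2*+bit x b) (cong₂ (λ u v → u ∷ v ∷ []) (half-2*+bit x b) (half-2*+bit y b)) ,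
  pos

layoutOf₂ : Term → List ℕ
layoutOf₂ s = uncurry layout₂ (columns s)

decode₂-layoutOf₂ : ∀ s → WellShaped s → decode₂ (layoutOf₂ s) ≡ s × LastPositive (layoutOf₂ s)
decode₂-layoutOf₂ empty _ = refl , tt
decode₂-layoutOf₂ (even t bs ms) = evenCase t bs ms
  where
  evenCase : ∀ t bs ms → WellShaped (even t bs ms) →
    decode₂ (layoutOf₂ (even t bs ms)) ≡ even t bs ms × LastPositive (layoutOf₂ (even t bs ms))
  evenCase true [] (x ∷ y ∷ []) _ rewrite parity-2*+bit x true =
    cong₂ (λ u v → even true [] (u ∷ v ∷ [])) (half-2*+bit x true) (half-2*+bit y true) , ℕₚ.m≤n+m 1 (2 * y)
  evenCase false [] (x ∷ y ∷ []) _ rewrite parity-2*+bit x false =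
    cong₂ (λ u v → even false [] (u ∷ v ∷ [])) (half-2*+bit x false) (cong pred (half-2*+bit (suc y) false)) , s≤s z≤n
  evenCase t (b ∷ bs) (x ∷ y ∷ m ∷ ms) len rewrite adjustLast-++ t (x ∷ y ∷ []) m ms =
    let (decoded , pos) = evenCase t bs (m ∷ ms) (ℕₚ.suc-injective (ℕₚ.suc-injective (trans len (2*suc (suc (length bs))))))
    in decode₂-pair x y b (layoutOf₂ (even t bs (m ∷ ms))) decoded tt pos
  evenCase t (b ∷ bs) (x ∷ y ∷ []) len =
    contradiction (ℕₚ.suc-injective (ℕₚ.suc-injective (trans len (2*suc (suc (length bs)))))) λ ()
decode₂-layoutOf₂ (odd bs ms) = oddCase bs ms
  where
  oddCase : ∀ bs ms → WellShaped (odd bs ms) →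
    decode₂ (layoutOf₂ (odd bs ms)) ≡ odd bs ms × LastPositive (layoutOf₂ (odd bs ms))
  oddCase [] (x ∷ []) _ = cong (λ h → odd [] (pred h ∷ [])) (half-2* (suc x)) , subst (1 ≤_) (sym (2*suc x)) (s≤s z≤n)
  oddCase (b ∷ bs) (x ∷ y ∷ m ∷ ms) len =
    let (decoded , pos) = oddCase bs (m ∷ ms) (ℕₚ.suc-injective (ℕₚ.suc-injective (trans len (cong suc (2*suc (length bs))))))
    in decode₂-pair x y b (layoutOf₂ (odd bs (m ∷ ms))) decoded tt pos
  oddCase (b ∷ bs) (x ∷ y ∷ []) len = contradiction (ℕₚ.suc-injective (trans len (cong suc (2*suc (length bs))))) λ ()

layoutOf₁ : Term → List ℕ
layoutOf₁ s = uncurry layout₁ (columns s)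

decode₁-tail-proper : ∀ d e cs → Proper (decode₁-tail d e cs)
decode₁-tail-proper d e [] with parity d
... | true = tt
... | false = tt
decode₁-tail-proper d e (f ∷ []) = tt
decode₁-tail-proper d e (f ∷ g ∷ cs) = prepend-proper _ _ _ (decode₁-tail f g cs) (decode₁-tail-proper f g cs)

layout₂-decode₁-tail : ∀ d e cs → Paired₂ (d ∷ e ∷ cs) → LastPositive (e ∷ cs) → layoutOf₂ (decode₁-tail d e cs) ≈₀ d ∷ e ∷ cs
layout₂-decode₁-tail d e [] (same , _) 1≤e with parity d in pd
... | true = 1 , cong₂ (λ u v → u ∷ v ∷ 0 ∷ []) (twice-half-of-odd d pd) (twice-half-of-odd e (sym same))
... | false = 0 , cong₂ (λ u v → u ∷ v ∷ []) (twice-half-of-even d pd) (twice-half-of-even-positive e (sym same) 1≤e)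
layout₂-decode₁-tail d e (f ∷ []) (same , f-even) 1≤f with parity d in pd
... | true = 0 , cong₃ (λ u v w → u ∷ v ∷ w ∷ [])
  (twice-half-of-odd d pd) (twice-half-of-odd e (sym same)) (twice-half-of-even f f-even)
... | false = 0 , cong₃ (λ u v w → u ∷ v ∷ w ∷ [])
  (trans (ℕₚ.+-identityʳ _) (twice-half-of-even d pd)) (trans (ℕₚ.+-identityʳ _) (twice-half-of-even e (sym same)))
  (twice-half-of-even-positive f f-even 1≤f)
layout₂-decode₁-tail d e (f ∷ g ∷ cs) (same , paired) pos =
  subst (_≈₀ d ∷ e ∷ f ∷ g ∷ cs)
    (sym (cong (uncurry layout₂)
      (columns-prepend (parity d) (⌊ d /2⌋ ∷ ⌊ e /2⌋ ∷ []) (decode₁-tail f g cs) (decode₁-tail-proper f g cs))))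
    (subst₂ (λ u v → u ∷ v ∷ _ ≈₀ d ∷ e ∷ f ∷ g ∷ cs) (sym (half-parity d)) (sym (twice-half-in-pair d e same))
      (∷-≈₀ d (∷-≈₀ e (layout₂-decode₁-tail f g cs paired pos))))

layout₁-decode₁ : ∀ c → Paired₁ c → LastPositive c → layoutOf₁ (decode₁ c) ≈₀ c
layout₁-decode₁ [] _ _ = ≈₀-refl
layout₁-decode₁ (c ∷ []) _ 1≤c with parity c in pc
... | true = 1 , cong (λ u → u ∷ 0 ∷ []) (twice-half-of-odd c pc)
... | false = 0 , cong (λ u → u ∷ []) (twice-half-of-even-positive c pc 1≤c)
layout₁-decode₁ (c ∷ d ∷ []) d-even 1≤d with parity c in pc
... | true = 0 , cong₂ (λ u v → u ∷ v ∷ []) (twice-half-of-odd c pc) (twice-half-of-even d d-even)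
... | false = 0 , cong₂ (λ u v → u ∷ v ∷ [])
  (trans (ℕₚ.+-identityʳ _) (twice-half-of-even c pc)) (twice-half-of-even-positive d d-even 1≤d)
layout₁-decode₁ (c ∷ d ∷ e ∷ cs) paired pos =
  subst (_≈₀ c ∷ d ∷ e ∷ cs)
    (sym (cong (uncurry layout₁) (columns-prepend (parity c) (⌊ c /2⌋ ∷ []) (decode₁-tail d e cs) (decode₁-tail-proper d e cs))))
    (subst (λ u → u ∷ _ ≈₀ c ∷ d ∷ e ∷ cs) (sym (half-parity c)) (∷-≈₀ c (layout₂-decode₁-tail d e cs paired pos)))

DecodesAsTail : Term → List ℕ → Set
DecodesAsTail s L = ∃[ d ] ∃[ e ] ∃[ cs ] dropTrailingZeros L ≡ d ∷ e ∷ cs × decode₁-tail d e cs ≡ s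

decodesAsTail-pair : ∀ x y b L s → DecodesAsTail s L →
  DecodesAsTail (prepend b (x ∷ y ∷ []) s) ((2 * x + bit b) ∷ (2 * y + bit b) ∷ L)
decodesAsTail-pair x y b L s (d , e , cs , stripped , decoded) =
  2 * x + bit b , 2 * y + bit b , d ∷ e ∷ cs ,
  cong (λ r → (2 * x + bit b) ∷ₚ (2 * y + bit b) ∷ₚ r) stripped ,
  trans (cong₂ (λ p h → prepend p h (decode₁-tail d e cs)) (parity-2*+bit x b)
          (cong₂ (λ u v → u ∷ v ∷ []) (half-2*+bit x b) (half-2*+bit y b)))
        (cong (prepend b (x ∷ y ∷ [])) decoded)

decode₁-tail-last-pair : ∀ x y b → decode₁-tail (2 * x + bit b) (2 * y + bit b) [] ≡
  (if b then even true [] (x ∷ y ∷ 0 ∷ []) else odd [] (x ∷ pred y ∷ []))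
decode₁-tail-last-pair x y b rewrite parity-2*+bit x b | half-2*+bit x b | half-2*+bit y b = refl

decode₁-tail-last-triple : ∀ x y b f →
  decode₁-tail (2 * x + bit b) (2 * y + bit b) (f ∷ []) ≡ even b [] (x ∷ y ∷ unadjustLast b f ∷ [])
decode₁-tail-last-triple x y b f rewrite parity-2*+bit x b | half-2*+bit x b | half-2*+bit y b = refl

decodesAsTail-layoutOf₂ : ∀ s → TailShaped s → DecodesAsTail s (layoutOf₂ s)
decodesAsTail-layoutOf₂ (even t bs ms) = evenCase t bs ms
  where
  evenCase : ∀ t bs ms → TailShaped (even t bs ms) → DecodesAsTail (even t bs ms) (layoutOf₂ (even t bs ms))
  evenCase true [] (x ∷ y ∷ zero ∷ []) _ =
    2 * x + bit true , 2 * y + bit true , [] , cong ((2 * x + 1) ∷ₚ_) (∷ₚ-positive [] (ℕₚ.m≤n+m 1 (2 * y))) ,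
    decode₁-tail-last-pair x y true
  evenCase true [] (x ∷ y ∷ suc z ∷ []) _ =
    2 * x + bit true , 2 * y + bit true , 2 * suc z ∷ [] , refl ,
    trans (decode₁-tail-last-triple x y true (2 * suc z)) (cong (λ w → even true [] (x ∷ y ∷ w ∷ [])) (half-2* (suc z)))
  evenCase false [] (x ∷ y ∷ z ∷ []) _ =
    2 * x + bit false , 2 * y + bit false , 2 * suc z ∷ [] , refl ,
    trans (decode₁-tail-last-triple x y false (2 * suc z)) (cong (λ w → even false [] (x ∷ y ∷ pred w ∷ [])) (half-2* (suc z)))
  evenCase t (b ∷ bs) (x ∷ y ∷ m ∷ ms) len rewrite adjustLast-++ t (x ∷ y ∷ []) m ms =
    decodesAsTail-pair x y b (layoutOf₂ (even t bs (m ∷ ms))) (even t bs (m ∷ ms))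
      (evenCase t bs (m ∷ ms) (ℕₚ.suc-injective (ℕₚ.suc-injective (trans len (cong suc (2*suc (suc (length bs))))))))
  evenCase t (b ∷ bs) (x ∷ y ∷ []) len = contradiction (ℕₚ.suc-injective (ℕₚ.suc-injective len)) λ ()
decodesAsTail-layoutOf₂ (odd bs ms) = oddCase bs ms
  where
  oddCase : ∀ bs ms → TailShaped (odd bs ms) → DecodesAsTail (odd bs ms) (layoutOf₂ (odd bs ms))
  oddCase [] (x ∷ y ∷ []) _ =
    2 * x + bit false , 2 * suc y + bit false , [] ,
    cong₂ (λ u v → u ∷ₚ v ∷ₚ []) (sym (ℕₚ.+-identityʳ (2 * x))) (sym (ℕₚ.+-identityʳ (2 * suc y))) ,
    decode₁-tail-last-pair x (suc y) false
  oddCase (b ∷ bs) (x ∷ y ∷ m ∷ ms) len =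
    decodesAsTail-pair x y b (layoutOf₂ (odd bs (m ∷ ms))) (odd bs (m ∷ ms))
      (oddCase bs (m ∷ ms) (ℕₚ.suc-injective (ℕₚ.suc-injective (trans len (2*suc (suc (length bs)))))))
  oddCase (b ∷ bs) (x ∷ y ∷ []) len =
    contradiction (ℕₚ.suc-injective (ℕₚ.suc-injective (trans len (2*suc (suc (length bs)))))) λ ()

decode₁-single : ∀ x b L s → DecodesAsTail s L → decode₁ (dropTrailingZeros ((2 * x + bit b) ∷ L)) ≡ prepend b (x ∷ []) s
decode₁-single x b L s (d , e , cs , stripped , refl) rewrite stripped | parity-2*+bit x b | half-2*+bit x b = refl

decode₁-layoutOf₁ : ∀ s → WellShaped s → decode₁ (dropTrailingZeros (layoutOf₁ s)) ≡ s
decode₁-layoutOf₁ empty _ = refl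
decode₁-layoutOf₁ (even true [] (x ∷ zero ∷ [])) _
  rewrite ∷ₚ-positive [] (ℕₚ.m≤n+m 1 (2 * x)) | parity-2*+bit x true | half-2*+bit x true = refl
decode₁-layoutOf₁ (even true [] (x ∷ suc y ∷ [])) _
  rewrite parity-2*+bit x true | half-2*+bit x true | half-2* (suc y) = refl
decode₁-layoutOf₁ (even false [] (x ∷ y ∷ [])) _
  rewrite parity-2*+bit x false | half-2*+bit x false | half-2* (suc y) = refl
decode₁-layoutOf₁ (even t (b ∷ bs) (x ∷ y ∷ ms)) len rewrite adjustLast-++ t (x ∷ []) y ms =
  decode₁-single x b (layoutOf₂ (even t bs (y ∷ ms))) (even t bs (y ∷ ms))
    (decodesAsTail-layoutOf₂ (even t bs (y ∷ ms)) (ℕₚ.suc-injective (trans len (2*suc (suc (length bs))))))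
decode₁-layoutOf₁ (odd [] (x ∷ [])) _ rewrite parity-2* (suc x) | half-2* (suc x) = refl
decode₁-layoutOf₁ (odd (b ∷ bs) (x ∷ y ∷ ms)) len =
  decode₁-single x b (layoutOf₂ (odd bs (y ∷ ms))) (odd bs (y ∷ ms))
    (decodesAsTail-layoutOf₂ (odd bs (y ∷ ms)) (ℕₚ.suc-injective len))
decode₁-layoutOf₁ (even t (b ∷ bs) (x ∷ [])) len = contradiction (ℕₚ.suc-injective len) λ ()
decode₁-layoutOf₁ (odd (b ∷ bs) (x ∷ [])) len = contradiction (ℕₚ.suc-injective len) λ ()

head₀-even : ∀ λs → OddIdxEven λs → parity (head₀ λs) ≡ false
head₀-even [] _ = refl
head₀-even (x ∷ xs) (2∣x , _) = parity-even 2∣x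

paired₂-diffs : ∀ λs → IsPartition λs → OddIdxEven λs → Paired₂ (diffs λs)
paired₂-diffs [] _ _ = tt
paired₂-diffs (x ∷ []) _ (2∣x , _) = parity-even 2∣x
paired₂-diffs (x ∷ y ∷ ys) p@(dec , _) (2∣x , rest-even) =
  parity-equal (x ∸ y) (y ∸ z) (trans (sym (parity-+even (x ∸ y + (y ∸ z)) (head₀-even ys rest-even)))
    (trans (cong parity (sym x≡)) (parity-even 2∣x))) ,
  paired₂-diffs ys (IsPartition-tail (IsPartition-tail p)) rest-even
  where
  z = head₀ ys
  x≡ : x ≡ x ∸ y + (y ∸ z) + z
  x≡ = begin
    x                     ≡⟨ sym (ℕₚ.m∸n+n≡m (head₀≤ dec)) ⟩
    x ∸ y + y             ≡⟨ cong (_+_ (x ∸ y)) (sym (ℕₚ.m∸n+n≡m (head₀≤ (Decreasing-tail dec)))) ⟩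
    x ∸ y + (y ∸ z + z)   ≡⟨ sym (ℕₚ.+-assoc (x ∸ y) (y ∸ z) z) ⟩
    x ∸ y + (y ∸ z) + z   ∎
    where open ≡-Reasoning

paired₁-diffs : ∀ λs → IsPartition λs → EvenIdxEven λs → Paired₁ (diffs λs)
paired₁-diffs [] _ _ = tt
paired₁-diffs (x ∷ xs) p rest-even = paired₂-diffs xs (IsPartition-tail p) rest-even

lastPositive-diffs : ∀ λs → IsPartition λs → LastPositive (diffs λs)
lastPositive-diffs [] _ = tt
lastPositive-diffs (x ∷ []) (_ , pos-∷ 1≤x _) = 1≤x
lastPositive-diffs (x ∷ y ∷ ys) p = lastPositive-diffs (y ∷ ys) (IsPartition-tail p)

-- The series as generating functions of terms

bitChoices : List Bool
bitChoices = false ∷ true ∷ []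

∈-bitChoices : ∀ b → b ∈ bitChoices
∈-bitChoices false = here refl
∈-bitChoices true = there (here refl)

bitChoices-unique : Unique bitChoices
bitChoices-unique = ((λ ()) ∷ []) ∷ [] ∷ []

∈-upTo-suc : ∀ {M m} → m ≤ M → m ∈ upTo (suc M)
∈-upTo-suc m≤M = ∈-upTo⁺ (s≤s m≤M)

bitWeight : ℤ → ℤ → ℕ → Bool → Weight
bitWeight α β i false = 0ʷ
bitWeight α β i true = α , β ℤ.+ + (4 * i)

multWeight : ℕ → ℕ → Weight
multWeight i k = + 0 , + (2 * suc i * k)

poch-genFun : ∀ α β n → poch (mono (ℤ.- + 1) α β) 4 n ≡ genFun (Σʷ (bitWeight α β) 0) (tuples n bitChoices)
poch-genFun α β n = prodBelow-genFun n bitChoices (bitWeight α β) _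
  (λ i → cong (λ a → (+ 1 , 0ʷ) ∷ (+ 1 , a , β ℤ.+ + (4 * i)) ∷ []) (ℤₚ.+-identityʳ α))

invQ2T-genFun : ∀ M m → invQ2T M m ≡ genFun (Σʷ multWeight 0) (tuples m (upTo (suc M)))
invQ2T-genFun M m = prodBelow-genFun m (upTo (suc M)) multWeight _ (λ i → sumBelow-monomials (suc M) (multWeight i))

qpow-⊗ : ∀ {A : Set} e (w : A → Weight) xs → qpow e ⊗ genFun w xs ≡ genFun (λ x → (+ 0 , e) +ʷ w x) xs
qpow-⊗ e w xs = trans (++-identityʳ _) (sym (map-∘ xs))

columnWeight : ℤ → ℤ → List Bool × List ℕ → Weight
columnWeight α β (βs , xs) = Σʷ (bitWeight α β) 0 βs +ʷ Σʷ multWeight 0 xs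

productTerms : ℕ → List (List Bool × List ℕ)
productTerms M = cartesianProduct (tuples M bitChoices) (tuples M (upTo (suc M)))

productT-genFun : ∀ α β M → productT (mono (ℤ.- + 1) α β) M ≡ genFun (columnWeight α β) (productTerms M)
productT-genFun α β M = begin
  poch (mono (ℤ.- + 1) α β) 4 M ⊗ invQ2T M M
    ≡⟨ cong₂ _⊗_ (poch-genFun α β M) (invQ2T-genFun M M) ⟩
  genFun (Σʷ (bitWeight α β) 0) (tuples M bitChoices) ⊗ genFun (Σʷ multWeight 0) (tuples M (upTo (suc M)))
    ≡⟨ genFun-⊗ _ _ (tuples M bitChoices) _ ⟩
  genFun (columnWeight α β) (productTerms M) ∎
  where open ≡-Reasoning

summand-genFun : ∀ e α β n m M →
  qpow e ⊗ poch (mono (ℤ.- + 1) α β) 4 n ⊗ invQ2T M m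
  ≡ genFun (λ (βs , ms) → (+ 0 , e) +ʷ Σʷ (bitWeight α β) 0 βs +ʷ Σʷ multWeight 0 ms)
      (cartesianProduct (tuples n bitChoices) (tuples m (upTo (suc M))))
summand-genFun e α β n m M = begin
  qpow e ⊗ poch (mono (ℤ.- + 1) α β) 4 n ⊗ invQ2T M m
    ≡⟨ cong₂ _⊗_ (trans (cong (qpow e ⊗_) (poch-genFun α β n)) (qpow-⊗ e _ (tuples n bitChoices))) (invQ2T-genFun M m) ⟩
  genFun (λ βs → (+ 0 , e) +ʷ Σʷ (bitWeight α β) 0 βs) (tuples n bitChoices) ⊗ genFun (Σʷ multWeight 0) (tuples m (upTo (suc M)))
    ≡⟨ genFun-⊗ _ _ (tuples n bitChoices) _ ⟩
  genFun _ (cartesianProduct (tuples n bitChoices) (tuples m (upTo (suc M)))) ∎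
  where open ≡-Reasoning

parts : ℕ → (ℕ → ℕ) → List (ℕ × List Bool × List ℕ)
parts M len = sigmaBelow M (λ n → cartesianProduct (tuples n bitChoices) (tuples (len n) (upTo (suc M))))

module _ (M : ℕ) (len : ℕ → ℕ) where

  ∈-parts⁻ : ∀ {n βs ms} → (n , βs , ms) ∈ parts M len →
    n < M × length βs ≡ n × length ms ≡ len n × All (_≤ M) ms
  ∈-parts⁻ {n} p∈ =
    let (n<M , q∈) = ∈-sigmaBelow⁻ _ M p∈
        (βs∈ , ms∈) = ∈-cartesianProduct⁻ (tuples n bitChoices) _ q∈
        (lenβs , _) = ∈-tuples⁻ n βs∈
        (lenms , ms∈U) = ∈-tuples⁻ (len n) ms∈
    in n<M , lenβs , lenms , All.map (λ m∈ → ℕₚ.≤-pred (∈-upTo⁻ m∈)) ms∈U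

  ∈-parts⁺ : ∀ {n βs ms} → n < M → length βs ≡ n → length ms ≡ len n → All (_≤ M) ms → (n , βs , ms) ∈ parts M len
  ∈-parts⁺ {n} n<M lenβs lenms ms≤M =
    ∈-sigmaBelow⁺ _ M n<M (∈-cartesianProduct⁺ (∈-tuples⁺ n lenβs (All.tabulate λ {b} _ → ∈-bitChoices b))
      (∈-tuples⁺ (len n) lenms (All.map ∈-upTo-suc ms≤M)))

  parts-unique : Unique (parts M len)
  parts-unique = sigmaBelow-unique _ M λ n →
    Unique.cartesianProduct⁺ (tuples-unique n bitChoices-unique) (tuples-unique (len n) (Unique.upTo⁺ (suc M)))

evenTerm : ℕ × List Bool × List ℕ → Term
evenTerm (_ , [] , _) = empty
evenTerm (_ , t ∷ bs , ms) = even t bs ms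

oddTerm : ℕ × List Bool × List ℕ → Term
oddTerm (_ , bs , ms) = odd bs ms

dsTerms : ℕ → List Term
dsTerms M = map evenTerm (parts M (2 *_)) ++ map oddTerm (parts M (suc ∘ (2 *_)))

dsWeight : ℤ → ℤ → ℤ → Term → Weight
dsWeight α βA βB empty = 0ʷ
dsWeight α βA βB (even t bs ms) = (+ 0 , + (4 * suc (length bs))) +ʷ Σʷ (bitWeight α βA) 0 (t ∷ bs) +ʷ Σʷ multWeight 0 ms
dsWeight α βA βB (odd bs ms) = (+ 0 , + (4 * length bs + 2)) +ʷ Σʷ (bitWeight α βB) 0 bs +ʷ Σʷ multWeight 0 ms

doubleSumT-genFun : ∀ α βA βB M →
  doubleSumT (mono (ℤ.- + 1) α βA) (mono (ℤ.- + 1) α βB) M ≡ genFun (dsWeight α βA βB) (dsTerms M)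
doubleSumT-genFun α βA βB M = begin
  doubleSumT (mono (ℤ.- + 1) α βA) (mono (ℤ.- + 1) α βB) M
    ≡⟨ cong₂ _⊕_ (sumBelow-genFun M _ _ _ (λ n → summand-genFun (+ (4 * n)) α βA n (2 * n) M))
                 (sumBelow-genFun M _ _ _ (λ n → summand-genFun (+ (4 * n + 2)) α βB n (suc (2 * n)) M)) ⟩
  genFun _ (parts M (2 *_)) ⊕ genFun _ (parts M (suc ∘ (2 *_)))
    ≡⟨ cong₂ _⊕_ (map-cong-local (All.tabulate evenWeight)) (map-cong-local (All.tabulate oddWeight)) ⟩
  genFun (dsWeight α βA βB ∘ evenTerm) (parts M (2 *_)) ⊕ genFun (dsWeight α βA βB ∘ oddTerm) (parts M (suc ∘ (2 *_)))
    ≡⟨ sym (cong₂ _⊕_ (genFun-map _ evenTerm (parts M (2 *_))) (genFun-map _ oddTerm (parts M (suc ∘ (2 *_))))) ⟩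
  genFun (dsWeight α βA βB) (map evenTerm (parts M (2 *_))) ⊕ genFun (dsWeight α βA βB) (map oddTerm (parts M (suc ∘ (2 *_))))
    ≡⟨ sym (genFun-++ _ (map evenTerm (parts M (2 *_))) _) ⟩
  genFun (dsWeight α βA βB) (dsTerms M) ∎
  where
  open ≡-Reasoning
  evenWeight : ∀ {p} → p ∈ parts M (2 *_) →
    (+ 1 , (+ 0 , + (4 * proj₁ p)) +ʷ Σʷ (bitWeight α βA) 0 (proj₁ (proj₂ p)) +ʷ Σʷ multWeight 0 (proj₂ (proj₂ p)))
    ≡ (+ 1 , dsWeight α βA βB (evenTerm p))
  evenWeight {n , [] , ms} p∈ with ∈-parts⁻ M (2 *_) p∈
  ... | _ , refl , _ with ms
  ... | [] = refl
  evenWeight {n , t ∷ bs , ms} p∈ with ∈-parts⁻ M (2 *_) p∈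
  ... | _ , refl , _ = refl
  oddWeight : ∀ {p} → p ∈ parts M (suc ∘ (2 *_)) →
    (+ 1 , (+ 0 , + (4 * proj₁ p + 2)) +ʷ Σʷ (bitWeight α βB) 0 (proj₁ (proj₂ p)) +ʷ Σʷ multWeight 0 (proj₂ (proj₂ p)))
    ≡ (+ 1 , dsWeight α βA βB (oddTerm p))
  oddWeight {n , bs , ms} p∈ with ∈-parts⁻ M (suc ∘ (2 *_)) p∈
  ... | _ , refl , _ = refl

dsTerms-wellShaped : ∀ M {s} → s ∈ dsTerms M → WellShaped s
dsTerms-wellShaped M s∈ with ∈-++⁻ (map evenTerm (parts M (2 *_))) s∈
... | inj₁ s∈′ with ∈-map⁻ evenTerm s∈′
... | (n , [] , ms) , _ , refl = _
... | (n , t ∷ bs , ms) , p∈ , refl = let (_ , lenβs , lenms , _) = ∈-parts⁻ M (2 *_) p∈ in trans lenms (cong (2 *_) (sym lenβs))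
dsTerms-wellShaped M s∈ | inj₂ s∈′ with ∈-map⁻ oddTerm s∈′
... | (n , bs , ms) , p∈ , refl =
  let (_ , lenβs , lenms , _) = ∈-parts⁻ M (suc ∘ (2 *_)) p∈ in trans lenms (cong (suc ∘ (2 *_)) (sym lenβs))

∈-dsTerms⁺ : ∀ M s → WellShaped s → 0 < M → length (proj₂ (columns s)) ≤ M → All (_≤ M) (proj₂ (columns s)) → s ∈ dsTerms M
∈-dsTerms⁺ M empty _ 0<M _ _ = ∈-++⁺ˡ (∈-map⁺ evenTerm (∈-parts⁺ M (2 *_) {0} {[]} {[]} 0<M refl refl []))
∈-dsTerms⁺ M (even t bs ms) len _ len≤M ms≤M =
  ∈-++⁺ˡ (∈-map⁺ evenTerm (∈-parts⁺ M (2 *_) n<M refl len (All-adjustLast⁻ t ms ms≤M)))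
  where
  n<M : suc (length bs) < M
  n<M = ℕₚ.<-≤-trans (subst (suc (length bs) <_) (sym (2*suc (length bs))) (s≤s (s≤s (ℕₚ.m≤m+n (length bs) _))))
          (ℕₚ.≤-trans (ℕₚ.≤-reflexive (sym len)) (ℕₚ.≤-trans (ℕₚ.≤-reflexive (sym (length-adjustLast t ms))) len≤M))
∈-dsTerms⁺ M (odd bs ms) len _ len≤M ms≤M =
  ∈-++⁺ʳ (map evenTerm (parts M (2 *_))) (∈-map⁺ oddTerm (∈-parts⁺ M (suc ∘ (2 *_)) n<M refl len (All-incLast⁻ ms ms≤M)))
  where
  n<M : length bs < M
  n<M = ℕₚ.≤-trans (s≤s (ℕₚ.m≤m+n (length bs) (length bs + 0)))
          (ℕₚ.≤-trans (ℕₚ.≤-reflexive (sym len)) (ℕₚ.≤-trans (ℕₚ.≤-reflexive (sym (length-incLast ms))) len≤M))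

dsTerms-unique : ∀ M → Unique (dsTerms M)
dsTerms-unique M =
  Unique.++⁺ (map⁺-injectiveOn evenTerm (parts-unique M (2 *_)) evenTerm-injective)
             (map⁺-injectiveOn oddTerm (parts-unique M (suc ∘ (2 *_))) oddTerm-injective)
             λ (s∈ , s∈′) → let (p , _ , s≡) = ∈-map⁻ evenTerm s∈ ; (q , _ , s≡′) = ∈-map⁻ oddTerm s∈′ in
                              even≢odd p q (trans (sym s≡) s≡′)
  where
  evenTerm-injective : ∀ {p q} → p ∈ parts M (2 *_) → q ∈ parts M (2 *_) → evenTerm p ≡ evenTerm q → p ≡ q
  evenTerm-injective {n , [] , ms} {n′ , [] , ms′} p∈ q∈ _
    with ∈-parts⁻ M (2 *_) p∈ | ∈-parts⁻ M (2 *_) q∈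
  ... | _ , refl , lenms , _ | _ , refl , lenms′ , _ with ms | ms′
  ... | [] | [] = refl
  evenTerm-injective {n , t ∷ bs , ms} {n′ , t′ ∷ bs′ , ms′} p∈ q∈ refl
    with ∈-parts⁻ M (2 *_) p∈ | ∈-parts⁻ M (2 *_) q∈
  ... | _ , refl , _ | _ , refl , _ = refl
  oddTerm-injective : ∀ {p q} → p ∈ parts M (suc ∘ (2 *_)) → q ∈ parts M (suc ∘ (2 *_)) → oddTerm p ≡ oddTerm q → p ≡ q
  oddTerm-injective {n , bs , ms} {n′ , bs′ , ms′} p∈ q∈ refl
    with ∈-parts⁻ M (suc ∘ (2 *_)) p∈ | ∈-parts⁻ M (suc ∘ (2 *_)) q∈
  ... | _ , refl , _ | _ , refl , _ = refl
  even≢odd : ∀ p q → evenTerm p ≢ oddTerm q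
  even≢odd (_ , [] , _) _ ()
  even≢odd (_ , _ ∷ _ , _) _ ()

∈-productTerms⁻ : ∀ M {βs ms} → (βs , ms) ∈ productTerms M → length βs ≡ M × length ms ≡ M
∈-productTerms⁻ M o∈ = let (βs∈ , ms∈) = ∈-cartesianProduct⁻ (tuples M bitChoices) _ o∈ in
  proj₁ (∈-tuples⁻ M βs∈) , proj₁ (∈-tuples⁻ M ms∈)

∈-productTerms⁺ : ∀ M {βs ms} → length βs ≡ M → length ms ≡ M → All (_≤ M) ms → (βs , ms) ∈ productTerms M
∈-productTerms⁺ M lenβs lenms ms≤M =
  ∈-cartesianProduct⁺ (∈-tuples⁺ M lenβs (All.tabulate λ {b} _ → ∈-bitChoices b)) (∈-tuples⁺ M lenms (All.map ∈-upTo-suc ms≤M))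

productTerms-unique : ∀ M → Unique (productTerms M)
productTerms-unique M = Unique.cartesianProduct⁺ (tuples-unique M bitChoices-unique) (tuples-unique M (Unique.upTo⁺ (suc M)))

columns-shape : ∀ s → WellShaped s → 2 * length (proj₁ (columns s)) ≤ length (proj₂ (columns s))
columns-shape empty _ = z≤n
columns-shape (even t bs ms) len = ℕₚ.≤-reflexive (begin
  2 * length (bs ∷ʳ t)     ≡⟨ cong (2 *_) (length-∷ʳ bs t) ⟩
  2 * suc (length bs)      ≡⟨ sym len ⟩
  length ms                ≡⟨ sym (length-adjustLast t ms) ⟩
  length (adjustLast t ms) ∎)
  where open ≡-Reasoning
columns-shape (odd bs ms) len =
  ℕₚ.≤-trans (ℕₚ.n≤1+n _) (ℕₚ.≤-reflexive (trans (sym len) (sym (length-incLast ms))))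

columnsLength : Term → ℕ
columnsLength s = length (proj₂ (columns s))

columnsLength-prepend : ∀ b xs s → Proper s → columnsLength (prepend b xs s) ≡ length xs + columnsLength s
columnsLength-prepend b xs s proper = trans (cong (length ∘ proj₂) (columns-prepend b xs s proper)) (length-++ xs)

columnsLength-decode₂ : ∀ c → columnsLength (decode₂ c) ≤ suc (length c)
columnsLength-decode₂ [] = z≤n
columnsLength-decode₂ (c ∷ []) = ℕₚ.n≤1+n 1
columnsLength-decode₂ (c ∷ d ∷ []) with parity c
... | true = ℕₚ.n≤1+n 2
... | false = ℕₚ.n≤1+n 2
columnsLength-decode₂ (c ∷ d ∷ cs@(e ∷ cs′)) =
  ℕₚ.≤-trans (ℕₚ.≤-reflexive (columnsLength-prepend _ (⌊ c /2⌋ ∷ ⌊ d /2⌋ ∷ []) (decode₂ cs) (decode₂-proper e cs′)))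
    (s≤s (s≤s (columnsLength-decode₂ cs)))

columnsLength-decode₁-tail : ∀ d e cs → columnsLength (decode₁-tail d e cs) ≤ suc (length (d ∷ e ∷ cs))
columnsLength-decode₁-tail d e [] with parity d
... | true = ℕₚ.≤-refl
... | false = ℕₚ.n≤1+n _
columnsLength-decode₁-tail d e (f ∷ []) with parity d
... | true = ℕₚ.n≤1+n _
... | false = ℕₚ.n≤1+n _
columnsLength-decode₁-tail d e (f ∷ g ∷ cs) =
  ℕₚ.≤-trans
    (ℕₚ.≤-reflexive (columnsLength-prepend _ (⌊ d /2⌋ ∷ ⌊ e /2⌋ ∷ []) (decode₁-tail f g cs) (decode₁-tail-proper f g cs)))
    (s≤s (s≤s (columnsLength-decode₁-tail f g cs)))

columnsLength-decode₁ : ∀ c → columnsLength (decode₁ c) ≤ suc (length c)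
columnsLength-decode₁ [] = z≤n
columnsLength-decode₁ (c ∷ []) with parity c
... | true = ℕₚ.≤-refl
... | false = ℕₚ.n≤1+n _
columnsLength-decode₁ (c ∷ d ∷ []) with parity c
... | true = ℕₚ.n≤1+n _
... | false = ℕₚ.n≤1+n _
columnsLength-decode₁ (c ∷ d ∷ e ∷ cs) =
  ℕₚ.≤-trans (ℕₚ.≤-reflexive (columnsLength-prepend _ (⌊ c /2⌋ ∷ []) (decode₁-tail d e cs) (decode₁-tail-proper d e cs)))
    (s≤s (columnsLength-decode₁-tail d e cs))

-- Weights of terms

Σʷ-bitWeight : ∀ α a i βs → Σʷ (bitWeight α (+ a)) i βs ≡ (α ℤ.* + ones βs , + (a * ones βs + 4 * moment i (map bit βs)))
Σʷ-bitWeight α a i [] = cong₂ _,_ (sym (ℤₚ.*-zeroʳ α)) (cong +_ (sym (solve-∀′ a)))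
  where
  solve-∀′ : ∀ a → a * 0 + 4 * 0 ≡ 0
  solve-∀′ = solve-∀
Σʷ-bitWeight α a i (false ∷ βs) rewrite Σʷ-bitWeight α a (suc i) βs | moment-suc i (map bit βs) =
  cong₂ _,_ (ℤₚ.+-identityˡ _) (trans (ℤₚ.+-identityˡ _) (cong +_ (lemma a i (ones βs) (moment i (map bit βs)))))
  where
  lemma : ∀ a i t m → a * t + 4 * (m + t) ≡ a * t + 4 * (i * 0 + (m + t))
  lemma = solve-∀
Σʷ-bitWeight α a i (true ∷ βs) rewrite Σʷ-bitWeight α a (suc i) βs | moment-suc i (map bit βs) =
  cong₂ _,_ (zStep α (+ ones βs)) (trans (sym (ℤₚ.pos-+ (a + 4 * i) _)) (cong +_ (lemma a i (ones βs) (moment i (map bit βs)))))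
  where
  zStep : ∀ α t → α ℤ.+ α ℤ.* t ≡ α ℤ.* (+ 1 ℤ.+ t)
  zStep = ℤ-Solver.solve-∀
  lemma : ∀ a i t m → a + 4 * i + (a * t + 4 * (m + t)) ≡ a * (1 + t) + 4 * (i * 1 + (m + t))
  lemma = solve-∀

Σʷ-multWeight : ∀ i ms → Σʷ multWeight i ms ≡ (+ 0 , + (2 * moment (suc i) ms))
Σʷ-multWeight i [] = refl
Σʷ-multWeight i (m ∷ ms) rewrite Σʷ-multWeight (suc i) ms =
  cong (+ 0 ,_) (trans (sym (ℤₚ.pos-+ (2 * suc i * m) _)) (cong +_ (lemma i m (moment (suc (suc i)) ms))))
  where
  lemma : ∀ i m s → 2 * suc i * m + 2 * s ≡ 2 * (suc i * m + s)
  lemma = solve-∀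

columnWeight-closed : ∀ α a βs xs →
  columnWeight α (+ a) (βs , xs) ≡ (α ℤ.* + ones βs , + (2 * moment 1 xs + (a * ones βs + 4 * moment 0 (map bit βs))))
columnWeight-closed α a βs xs rewrite Σʷ-bitWeight α a 0 βs | Σʷ-multWeight 0 xs =
  cong₂ _,_ (ℤₚ.+-identityʳ _)
    (trans (sym (ℤₚ.pos-+ (a * ones βs + 4 * moment 0 (map bit βs)) (2 * moment 1 xs))) (cong +_ (ℕₚ.+-comm _ (2 * moment 1 xs))))

pos-4*suc : ∀ i → + (4 * suc i) ≡ + 4 ℤ.+ + (4 * i)
pos-4*suc i = cong +_ (lemma i)
  where
  lemma : ∀ i → 4 * suc i ≡ 4 + 4 * i
  lemma = solve-∀

bitWeight-shift : ∀ α a i b → bitWeight α (+ a ℤ.- + 4) (suc i) b ≡ bitWeight α (+ a) i b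
bitWeight-shift α a i false = refl
bitWeight-shift α a i true = cong (α ,_) (trans (cong (ℤ._+_ (+ a ℤ.- + 4)) (pos-4*suc i)) (lemma (+ a) (+ (4 * i))))
  where
  lemma : ∀ a x → a ℤ.- + 4 ℤ.+ (+ 4 ℤ.+ x) ≡ a ℤ.+ x
  lemma = ℤ-Solver.solve-∀

Σʷ-multWeight-incLast : ∀ i m ms →
  Σʷ multWeight i (incLast (m ∷ ms)) ≡ Σʷ multWeight i (m ∷ ms) +ʷ (+ 0 , + (2 * (suc i + length ms)))
Σʷ-multWeight-incLast i m [] = cong (+ 0 ,_) (trans (cong +_ (lemma i m)) (ℤₚ.pos-+ (2 * suc i * m + 0) (2 * (suc i + 0))))
  where
  lemma : ∀ i m → 2 * suc i * suc m + 0 ≡ 2 * suc i * m + 0 + 2 * (suc i + 0)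
  lemma = solve-∀
Σʷ-multWeight-incLast i m (m′ ∷ ms) = begin
  multWeight i m +ʷ Σʷ multWeight (suc i) (incLast (m′ ∷ ms))
    ≡⟨ cong (multWeight i m +ʷ_) (Σʷ-multWeight-incLast (suc i) m′ ms) ⟩
  multWeight i m +ʷ (Σʷ multWeight (suc i) (m′ ∷ ms) +ʷ (+ 0 , + (2 * (suc (suc i) + length ms))))
    ≡⟨ sym (+ʷ-assoc (multWeight i m) (Σʷ multWeight (suc i) (m′ ∷ ms)) (+ 0 , + (2 * (suc (suc i) + length ms)))) ⟩
  Σʷ multWeight i (m ∷ m′ ∷ ms) +ʷ (+ 0 , + (2 * (suc (suc i) + length ms)))
    ≡⟨ cong (λ n → Σʷ multWeight i (m ∷ m′ ∷ ms) +ʷ (+ 0 , + (2 * n))) (sym (ℕₚ.+-suc (suc i) (length ms))) ⟩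
  Σʷ multWeight i (m ∷ m′ ∷ ms) +ʷ (+ 0 , + (2 * (suc i + length (m′ ∷ ms)))) ∎
  where open ≡-Reasoning

dsWeight-even-true : ∀ α a bs ms →
  dsWeight α (+ a ℤ.- + 4) (+ a) (even true bs ms) ≡ columnWeight α (+ a) (columns (even true bs ms))
dsWeight-even-true α a bs ms = begin
  (+ 0 , + (4 * suc l)) +ʷ (bitWeight α A-4 0 true +ʷ Σʷ (bitWeight α A-4) 1 bs) +ʷ Ms
    ≡⟨ cong (λ B → (+ 0 , + (4 * suc l)) +ʷ (bitWeight α A-4 0 true +ʷ B) +ʷ Ms) (Σʷ-shift _ _ (bitWeight-shift α a) 0 bs) ⟩
  (+ 0 , + (4 * suc l)) +ʷ (bitWeight α A-4 0 true +ʷ B) +ʷ Ms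
    ≡⟨ cong₂ _,_ (lemma₁ α (proj₁ B) (proj₁ Ms))
                 (trans (cong (λ x → x ℤ.+ (A-4 ℤ.+ + 0 ℤ.+ proj₂ B) ℤ.+ proj₂ Ms) (pos-4*suc l))
                        (lemma₂ (+ a) (+ (4 * l)) (proj₂ B) (proj₂ Ms))) ⟩
  B +ʷ bitWeight α (+ a) (0 + l) true +ʷ Ms
    ≡⟨ cong (_+ʷ Ms) (sym (Σʷ-∷ʳ (bitWeight α (+ a)) 0 bs true)) ⟩
  columnWeight α (+ a) (columns (even true bs ms)) ∎
  where
  open ≡-Reasoning
  l = length bs
  A-4 = + a ℤ.- + 4
  B = Σʷ (bitWeight α (+ a)) 0 bs
  Ms = Σʷ multWeight 0 ms
  lemma₁ : ∀ α b m → + 0 ℤ.+ (α ℤ.+ b) ℤ.+ m ≡ b ℤ.+ α ℤ.+ m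
  lemma₁ = ℤ-Solver.solve-∀
  lemma₂ : ∀ a x b m → + 4 ℤ.+ x ℤ.+ (a ℤ.- + 4 ℤ.+ + 0 ℤ.+ b) ℤ.+ m ≡ b ℤ.+ (a ℤ.+ x) ℤ.+ m
  lemma₂ = ℤ-Solver.solve-∀

dsWeight-even-false : ∀ α a bs m ms → WellShaped (even false bs (m ∷ ms)) →
  dsWeight α (+ a ℤ.- + 4) (+ a) (even false bs (m ∷ ms)) ≡ columnWeight α (+ a) (columns (even false bs (m ∷ ms)))
dsWeight-even-false α a bs m ms len = begin
  (+ 0 , + (4 * suc l)) +ʷ (0ʷ +ʷ Σʷ (bitWeight α A-4) 1 bs) +ʷ Ms
    ≡⟨ cong (λ B → (+ 0 , + (4 * suc l)) +ʷ (0ʷ +ʷ B) +ʷ Ms) (Σʷ-shift _ _ (bitWeight-shift α a) 0 bs) ⟩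
  (+ 0 , + (4 * suc l)) +ʷ (0ʷ +ʷ B) +ʷ Ms
    ≡⟨ cong₂ _,_ (lemma₁ (proj₁ B) (proj₁ Ms)) (trans (cong (λ x → + x ℤ.+ (+ 0 ℤ.+ proj₂ B) ℤ.+ proj₂ Ms) (4*suc l))
                                                        (lemma₂ (+ (2 * (2 * suc l))) (proj₂ B) (proj₂ Ms))) ⟩
  B +ʷ 0ʷ +ʷ (Ms +ʷ (+ 0 , + (2 * (2 * suc l))))
    ≡⟨ cong₂ (λ B′ n → B′ +ʷ (Ms +ʷ (+ 0 , + (2 * n)))) (sym (Σʷ-∷ʳ (bitWeight α (+ a)) 0 bs false)) (sym len) ⟩
  Σʷ (bitWeight α (+ a)) 0 (bs ∷ʳ false) +ʷ (Ms +ʷ (+ 0 , + (2 * (1 + length ms))))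
    ≡⟨ cong (Σʷ (bitWeight α (+ a)) 0 (bs ∷ʳ false) +ʷ_) (sym (Σʷ-multWeight-incLast 0 m ms)) ⟩
  columnWeight α (+ a) (columns (even false bs (m ∷ ms))) ∎
  where
  open ≡-Reasoning
  l = length bs
  A-4 = + a ℤ.- + 4
  B = Σʷ (bitWeight α (+ a)) 0 bs
  Ms = Σʷ multWeight 0 (m ∷ ms)
  4*suc : ∀ l → 4 * suc l ≡ 2 * (2 * suc l)
  4*suc = solve-∀
  lemma₁ : ∀ b m → + 0 ℤ.+ (+ 0 ℤ.+ b) ℤ.+ m ≡ b ℤ.+ + 0 ℤ.+ (m ℤ.+ + 0)
  lemma₁ = ℤ-Solver.solve-∀
  lemma₂ : ∀ x b m → x ℤ.+ (+ 0 ℤ.+ b) ℤ.+ m ≡ b ℤ.+ + 0 ℤ.+ (m ℤ.+ x)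
  lemma₂ = ℤ-Solver.solve-∀

dsWeight-odd : ∀ α a bs m ms → WellShaped (odd bs (m ∷ ms)) →
  dsWeight α (+ a ℤ.- + 4) (+ a) (odd bs (m ∷ ms)) ≡ columnWeight α (+ a) (columns (odd bs (m ∷ ms)))
dsWeight-odd α a bs m ms len = begin
  (+ 0 , + (4 * l + 2)) +ʷ B +ʷ Ms
    ≡⟨ cong₂ _,_ (lemma₁ (proj₁ B) (proj₁ Ms)) (trans (cong (λ x → + x ℤ.+ proj₂ B ℤ.+ proj₂ Ms) (4*+2 l))
                                                        (lemma₂ (+ (2 * suc (2 * l))) (proj₂ B) (proj₂ Ms))) ⟩
  B +ʷ (Ms +ʷ (+ 0 , + (2 * suc (2 * l))))
    ≡⟨ cong (λ n → B +ʷ (Ms +ʷ (+ 0 , + (2 * n)))) (sym len) ⟩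
  B +ʷ (Ms +ʷ (+ 0 , + (2 * (1 + length ms))))
    ≡⟨ cong (B +ʷ_) (sym (Σʷ-multWeight-incLast 0 m ms)) ⟩
  columnWeight α (+ a) (columns (odd bs (m ∷ ms))) ∎
  where
  open ≡-Reasoning
  l = length bs
  B = Σʷ (bitWeight α (+ a)) 0 bs
  Ms = Σʷ multWeight 0 (m ∷ ms)
  4*+2 : ∀ l → 4 * l + 2 ≡ 2 * suc (2 * l)
  4*+2 = solve-∀
  lemma₁ : ∀ b m → + 0 ℤ.+ b ℤ.+ m ≡ b ℤ.+ (m ℤ.+ + 0)
  lemma₁ = ℤ-Solver.solve-∀
  lemma₂ : ∀ x b m → x ℤ.+ b ℤ.+ m ≡ b ℤ.+ (m ℤ.+ x)
  lemma₂ = ℤ-Solver.solve-∀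

dsWeight-columnWeight : ∀ α a s → WellShaped s →
  dsWeight α (+ a ℤ.- + 4) (+ a) s ≡ columnWeight α (+ a) (columns s)
dsWeight-columnWeight α a empty _ = refl
dsWeight-columnWeight α a (even true bs ms) _ = dsWeight-even-true α a bs ms
dsWeight-columnWeight α a (even false bs (m ∷ ms)) len = dsWeight-even-false α a bs m ms len
dsWeight-columnWeight α a (odd bs (m ∷ ms)) len = dsWeight-odd α a bs m ms len

-- The encodings of 𝒫₁ and 𝒫₂

-- A family 𝒫 with its layout; the product for 𝒫 is (−z^α q^a;q⁴)_∞/(q²;q²)_∞.
record Encoding : Set₁ where
  field
    InP : List ℕ → Set
    layout : List Bool → List ℕ → List ℕ
    decode : List ℕ → Term
    α : ℤ
    a : ℕ
    inP-layout : ∀ βs xs → InP (fromDiffs (layout βs xs))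
    BG-layout : ∀ βs xs → BG (fromDiffs (layout βs xs)) ≡ α ℤ.* + ones βs
    size-layout : ∀ βs xs → size (fromDiffs (layout βs xs)) ≡ 2 * moment 1 xs + (a * ones βs + 4 * moment 0 (map bit βs))
    decode-layout : ∀ s → WellShaped s → decode (dropTrailingZeros (uncurry layout (columns s))) ≡ s
    decode-wellShaped : ∀ c → WellShaped (decode c)
    columnsLength-decode : ∀ c → columnsLength (decode c) ≤ suc (length c)
    layout-decode : ∀ λs → IsPartition λs → InP λs → uncurry layout (columns (decode (diffs λs))) ≈₀ diffs λs
    layout-padding : ∀ βs xs m n → 2 * length βs ≤ length xs →
      layout (βs ++ replicate m false) (xs ++ replicate n 0) ≈₀ layout βs xs
    layout-injective : ∀ βs βs′ xs xs′ → length βs ≡ length βs′ → length xs ≡ length xs′ →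
      layout βs xs ≡ layout βs′ xs′ → βs ≡ βs′ × xs ≡ xs′
    length-layout-cong : ∀ βs βs′ xs xs′ → length βs ≡ length βs′ → length xs ≡ length xs′ →
      length (layout βs xs) ≡ length (layout βs′ xs′)

module Counting (E : Encoding) where

  open Encoding E

  partitionOf : List Bool × List ℕ → List ℕ
  partitionOf o = fromDiffs (uncurry layout o)

  columnWeight-partitionOf : ∀ o → columnWeight α (+ a) o ≡ (BG (partitionOf o) , + size (partitionOf o))
  columnWeight-partitionOf (βs , xs) =
    trans (columnWeight-closed α a βs xs) (sym (cong₂ _,_ (BG-layout βs xs) (cong +_ (size-layout βs xs))))

  partitionOf-weight : ∀ {N k} o → columnWeight α (+ a) o ≡ (k , + N) → PartitionOf InP N k (partitionOf o)
  partitionOf-weight o@(βs , xs) w≡ =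
    let w≡′ = trans (sym (columnWeight-partitionOf o)) w≡ in
    fromDiffs-isPartition (layout βs xs) , ℤₚ.+-injective (cong proj₂ w≡′) , inP-layout βs xs , cong proj₁ w≡′

  decode-partitionOf : ∀ s → WellShaped s → decode (diffs (partitionOf (columns s))) ≡ s
  decode-partitionOf s shaped = trans (cong decode (diffs-fromDiffs (uncurry layout (columns s)))) (decode-layout s shaped)

  columnsOf : List ℕ → List Bool × List ℕ
  columnsOf λs = columns (decode (diffs λs))

  partitionOf-columnsOf : ∀ {λs} → IsPartition λs → InP λs → partitionOf (columnsOf λs) ≡ λs
  partitionOf-columnsOf {λs} p inP = trans (fromDiffs-≈₀ (layout-decode λs p inP)) (fromDiffs-diffs λs p)

  module _ {N k M} (N<M : N < M) {λs} (λs∈ : PartitionOf InP N k λs) where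

    private
      p = proj₁ λs∈
      size≡N = proj₁ (proj₂ λs∈)
      inP = proj₁ (proj₂ (proj₂ λs∈))
      BG≡k = proj₂ (proj₂ (proj₂ λs∈))
      βs = proj₁ (columnsOf λs)
      xs = proj₂ (columnsOf λs)

    columnWeight-columnsOf : columnWeight α (+ a) (columnsOf λs) ≡ (k , + N)
    columnWeight-columnsOf = trans (columnWeight-partitionOf (columnsOf λs))
      (trans (cong (λ μ → BG μ , + size μ) (partitionOf-columnsOf p inP)) (cong₂ _,_ BG≡k (cong +_ size≡N)))

    columnsOf-length : length xs ≤ M
    columnsOf-length = begin
      length xs               ≤⟨ columnsLength-decode (diffs λs) ⟩
      suc (length (diffs λs)) ≡⟨ cong suc (length-diffs λs) ⟩
      suc (length λs)         ≤⟨ s≤s (length≤size (proj₂ p)) ⟩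
      suc (size λs)           ≡⟨ cong suc size≡N ⟩
      suc N                   ≤⟨ N<M ⟩
      M                       ∎
      where open ℕₚ.≤-Reasoning

    columnsOf-bounded : All (_≤ M) xs
    columnsOf-bounded = All.map (λ x≤ → ℕₚ.≤-trans x≤ (ℕₚ.≤-trans moment≤N (ℕₚ.<⇒≤ N<M))) (moment-bound 0 xs)
      where
      moment≤N : moment 1 xs ≤ N
      moment≤N = begin
        moment 1 xs                                                  ≤⟨ ℕₚ.m≤n*m _ 2 ⟩
        2 * moment 1 xs                                              ≤⟨ ℕₚ.m≤m+n _ _ ⟩
        2 * moment 1 xs + (a * ones βs + 4 * moment 0 (map bit βs))  ≡⟨ sym (size-layout βs xs) ⟩
        size (partitionOf (βs , xs))                                 ≡⟨ cong size (partitionOf-columnsOf p inP) ⟩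
        size λs                                                      ≡⟨ size≡N ⟩
        N                                                            ∎
        where open ℕₚ.≤-Reasoning

  countIs-doubleSum : ∀ {N k M} → N < M →
    CountIs InP N k (coeff (doubleSumT (mono (ℤ.- + 1) α (+ a ℤ.- + 4)) (mono (ℤ.- + 1) α (+ a)) M) k (+ N))
  countIs-doubleSum {N} {k} {M} N<M rewrite doubleSumT-genFun α (+ a ℤ.- + 4) (+ a) M =
    countIs-genFun weight (partitionOf ∘ columns) (dsTerms-unique M) sound injective complete
    where
    weight = dsWeight α (+ a ℤ.- + 4) (+ a)
    sound : ∀ {s} → s ∈ dsTerms M → weight s ≡ (k , + N) → PartitionOf InP N k (partitionOf (columns s))
    sound {s} s∈ w≡ = partitionOf-weight (columns s) (trans (sym (dsWeight-columnWeight α a s (dsTerms-wellShaped M s∈))) w≡)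
    injective : ∀ {s s′} → s ∈ dsTerms M → s′ ∈ dsTerms M → _ → _ → partitionOf (columns s) ≡ partitionOf (columns s′) → s ≡ s′
    injective {s} {s′} s∈ s′∈ _ _ eq = begin
      s                                    ≡⟨ sym (decode-partitionOf s (dsTerms-wellShaped M s∈)) ⟩
      decode (diffs (partitionOf (columns s)))  ≡⟨ cong (decode ∘ diffs) eq ⟩
      decode (diffs (partitionOf (columns s′))) ≡⟨ decode-partitionOf s′ (dsTerms-wellShaped M s′∈) ⟩
      s′                                   ∎
      where open ≡-Reasoning
    complete : ∀ {λs} → PartitionOf InP N k λs → ∃[ s ] s ∈ dsTerms M × weight s ≡ (k , + N) × partitionOf (columns s) ≡ λs
    complete {λs} λs∈@(p , _ , inP , _) =
      s ,
      ∈-dsTerms⁺ M s shaped (ℕₚ.≤-trans (s≤s z≤n) N<M) (columnsOf-length N<M λs∈) (columnsOf-bounded N<M λs∈) ,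
      trans (dsWeight-columnWeight α a s shaped) (columnWeight-columnsOf N<M λs∈) ,
      partitionOf-columnsOf p inP
      where
      s = decode (diffs λs)
      shaped = decode-wellShaped (diffs λs)

  countIs-product : ∀ {N k M} → N < M → CountIs InP N k (coeff (productT (mono (ℤ.- + 1) α (+ a)) M) k (+ N))
  countIs-product {N} {k} {M} N<M rewrite productT-genFun α (+ a) M =
    countIs-genFun (columnWeight α (+ a)) partitionOf (productTerms-unique M) (λ _ → partitionOf-weight _) injective complete
    where
    injective : ∀ {o o′} → o ∈ productTerms M → o′ ∈ productTerms M → _ → _ → partitionOf o ≡ partitionOf o′ → o ≡ o′
    injective {βs , xs} {βs′ , xs′} o∈ o′∈ _ _ eq =
      let (lenβs , lenxs) = ∈-productTerms⁻ M o∈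
          (lenβs′ , lenxs′) = ∈-productTerms⁻ M o′∈
          sameLengths = length-layout-cong βs βs′ xs xs′ (trans lenβs (sym lenβs′)) (trans lenxs (sym lenxs′))
          stripped = trans (sym (diffs-fromDiffs (layout βs xs))) (trans (cong diffs eq) (diffs-fromDiffs (layout βs′ xs′)))
          (βs≡ , xs≡) = layout-injective βs βs′ xs xs′ (trans lenβs (sym lenβs′)) (trans lenxs (sym lenxs′))
                          (dropTrailingZeros-injective _ _ stripped sameLengths)
      in cong₂ _,_ βs≡ xs≡
    padTo : ∀ {A : Set} → A → List A → List A
    padTo z ys = ys ++ replicate (M ∸ length ys) z
    length-padTo : ∀ {A : Set} (z : A) ys → length ys ≤ M → length (padTo z ys) ≡ M
    length-padTo z ys ys≤M =
      trans (length-++ ys) (trans (cong (_+_ (length ys)) (length-replicate (M ∸ length ys))) (ℕₚ.m+[n∸m]≡n ys≤M))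
    complete : ∀ {λs} → PartitionOf InP N k λs →
      ∃[ o ] o ∈ productTerms M × columnWeight α (+ a) o ≡ (k , + N) × partitionOf o ≡ λs
    complete {λs} λs∈@(p , _ , inP , _) =
      o ,
      ∈-productTerms⁺ M (length-padTo false βs βs≤M) (length-padTo 0 xs xs≤M)
        (All.++⁺ (columnsOf-bounded N<M λs∈) (All.replicate⁺ _ z≤n)) ,
      trans (columnWeight-partitionOf o) (trans (cong (λ μ → BG μ , + size μ) padded≡)
        (trans (sym (columnWeight-partitionOf (βs , xs))) (columnWeight-columnsOf N<M λs∈))) ,
      trans padded≡ (partitionOf-columnsOf p inP)
      where
      βs = proj₁ (columnsOf λs)
      xs = proj₂ (columnsOf λs)
      o = padTo false βs , padTo 0 xs
      shape = columns-shape (decode (diffs λs)) (decode-wellShaped (diffs λs))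
      xs≤M = columnsOf-length N<M λs∈
      βs≤M = ℕₚ.≤-trans (ℕₚ.m≤n*m (length βs) 2) (ℕₚ.≤-trans shape xs≤M)
      padded≡ : partitionOf o ≡ partitionOf (βs , xs)
      padded≡ = fromDiffs-≈₀ (layout-padding βs xs _ _ shape)

encoding₁ : Encoding
encoding₁ = record
  { InP = InP1
  ; layout = layout₁
  ; decode = decode₁
  ; α = + 1
  ; a = 1
  ; inP-layout = inP₁-layout₁
  ; BG-layout = λ βs xs → trans (BG-layout₁ βs xs) (sym (ℤₚ.*-identityˡ _))
  ; size-layout = size-layout₁
  ; decode-layout = decode₁-layoutOf₁
  ; decode-wellShaped = decode₁-wellShaped
  ; columnsLength-decode = columnsLength-decode₁
  ; layout-decode = λ λs p inP → layout₁-decode₁ (diffs λs) (paired₁-diffs λs p inP) (lastPositive-diffs λs p)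
  ; layout-padding = layout₁-padding
  ; layout-injective = layout₁-injective
  ; length-layout-cong = length-layout₁-cong
  }

encoding₂ : Encoding
encoding₂ = record
  { InP = InP2
  ; layout = layout₂
  ; decode = decode₂
  ; α = ℤ.- + 1
  ; a = 3
  ; inP-layout = inP₂-layout₂
  ; BG-layout = λ βs xs → trans (BG-layout₂ βs xs) (sym (ℤₚ.-1*i≡-i _))
  ; size-layout = size-layout₂
  ; decode-layout = λ s shaped → let (decoded , pos) = decode₂-layoutOf₂ s shaped in
      trans (cong decode₂ (dropTrailingZeros-lastPositive (layoutOf₂ s) pos)) decoded
  ; decode-wellShaped = decode₂-wellShaped
  ; columnsLength-decode = columnsLength-decode₂
  ; layout-decode = λ λs p inP → subst (_≈₀ diffs λs)
      (sym (layout₂-decode₂ (diffs λs) (paired₂-diffs λs p inP) (lastPositive-diffs λs p))) ≈₀-refl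
  ; layout-padding = layout₂-padding
  ; layout-injective = layout₂-injective
  ; length-layout-cong = length-layout₂-cong
  }

open Counting

mainTheorem13 :
    ∀ (N : ℕ) (k : ℤ) (M : ℕ) → N < M →
      (CountIs InP1 N k (coeff (doubleSumT -zq⁻³ -zq M) k (+ N))
        × coeff (doubleSumT -zq⁻³ -zq M) k (+ N) ≡ coeff (productT -zq M) k (+ N))
      × (CountIs InP2 N k (coeff (doubleSumT -z⁻¹q⁻¹ -z⁻¹q³ M) k (+ N))
        × coeff (doubleSumT -z⁻¹q⁻¹ -z⁻¹q³ M) k (+ N) ≡ coeff (productT -z⁻¹q³ M) k (+ N))
mainTheorem13 N k M N<M =
  (countIs-doubleSum encoding₁ N<M , countIs-unique (countIs-doubleSum encoding₁ N<M) (countIs-product encoding₁ N<M)) ,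
  (countIs-doubleSum encoding₂ N<M , countIs-unique (countIs-doubleSum encoding₂ N<M) (countIs-product encoding₂ N<M))
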